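{- There exist constants $\alpha>1$ and $0<\beta<1$ such that the following holds. If $H$ is a pseudoexpander with a sufficiently large number $n=|V(H)|$ of vertices, and $Z$ is a $d$-NBP computing $\phi_H$ with $d\le \log n/10^5$, then $|Z|\ge \alpha^{n^{\beta}}$.
   Context: All logarithms are base 2. Sets of literals never contain a variable together with its negation; for a set $S$ of literals, $Vars(S)$ is its set of variables, and $S$ is identified with the truth assignment to $Vars(S)$ making its literals true. A non-deterministic branching program (NBP) $Z$ is a directed acyclic multigraph with one source and one sink, some of whose edges are labelled with literals; $|Z|$ is its number of vertices. A source–sink path $P$ is a computational path if no variable occurs on $P$ both positively and negatively; $A(P)$ is the set of literals labelling edges of $P$. $Z$ computes a Boolean function $f$ on a variable set $V$ if for every truth assignment $S$ to $V$: $f(S)=1$ iff $A(P)\subseteq S$ for some computational path $P$ of $Z$. $Z$ is a (syntactic) $d$-NBP if each variable occurs at most $d$ times as an edge label on every source–sink path. A rooted tree is extended if none of its leaves has a sibling. A graph $H$ is a binary-tree-based graph if it is an edge-disjoint union of extended rooted trees $T_1,\dots,T_m$ with roots $t_1,\dots,t_m$ (the roots of $H$, forming ${\bf Roots}(H)$), such that every vertex that is a leaf of some $T_i$ is a leaf of exactly two of the trees, and any two trees share at most one vertex, which is a leaf in both. $T_i,T_j$ are adjacent if they share a leaf, denoted $\ell_{i,j}$; then $\{t_i,t_j\}$ is a pseudoedge, and $P_{i,j}$ is the path from $t_i$ to $t_j$ in $T_i\cup T_j$. A pseudomatching is a set of pseudoedges with pairwise disjoint ends; it is between disjoint $U,V\subseteq{\bf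 Roots}(H)$ if each of its pseudoedges has one end in $U$ and one in $V$. Write $m=|{\bf Roots}(H)|$. $H$ is a pseudoexpander if (1) every $T_i$ has height (maximum number of vertices on a root–leaf path) at most $(\log m)/4.9+3$, and (2) for any disjoint $U,V\subseteq{\bf Roots}(H)$ with $|U|,|V|\ge m^{0.999}$ there is a pseudomatching between $U$ and $V$ of size at least $m^{0.999}/3$. $\phi_H$ is the monotone CNF with variable set $V(H)$ having, for each pseudoedge $\{t_i,t_j\}$, the clause $C_{i,j}=\bigvee_{v\in V(P_{i,j})} v$. -}

module Defs where

open import Data.Nat using (ℕ; zero; suc; _+_; _*_; _∸_; _^_; _≤_; _<_)
open import Data.Fin using (Fin) renaming (_≟_ to _≟ᶠ_)
open import Data.Fin.Subset using (Subset; _∈_; _∉_; _⊆_; ⁅_⁆; ⋃; ∣_∣)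
open import Data.Bool using (Bool; true; false)
open import Data.Maybe using (Maybe; just; nothing)
open import Data.Product using (Σ; ∃; ∃-syntax; _×_; _,_; proj₁; proj₂)
open import Data.Sum using (_⊎_)
open import Data.Empty using (⊥)
open import Data.List using (List; []; _∷_; map; length; filter; concatMap; allFin)
open import Data.List.Relation.Unary.All using (All)
open import Data.List.Relation.Unary.Unique.Propositional using (Unique)
import Data.List.Membership.Propositional as LM
open import Relation.Nullary using (¬_)
open import Relation.Binary.PropositionalEquality using (_≡_; _≢_)
open import Function.Bundles using (_⇔_)

iter : ∀ {A : Set} → (A → A) → ℕ → A → A
iter f zero    x = x
iter f (suc k) x = f (iter f k x)

record RTree (n : ℕ) : Set where
  field
    verts   : Subset n
    root    : Fin n
    parent  : Fin n → Fin n
    root∈   : root ∈ verts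
    parent∈ : ∀ v → v ∈ verts → v ≢ root → parent v ∈ verts
    reaches : ∀ v → v ∈ verts → ∃[ k ] iter parent k v ≡ root
open RTree public

Child : ∀ {n} → RTree n → Fin n → Fin n → Set
Child T u w = w ∈ verts T × w ≢ root T × parent T w ≡ u

IsLeaf : ∀ {n} → RTree n → Fin n → Set
IsLeaf T v = v ∈ verts T × (∀ w → ¬ Child T v w)

Extended : ∀ {n} → RTree n → Set
Extended T = ∀ v w → IsLeaf T v → v ≢ root T → Child T (parent T v) w → w ≡ v

TreeEdge : ∀ {n} → RTree n → Fin n → Fin n → Set
TreeEdge T a b = ∃[ v ] (v ∈ verts T × v ≢ root T ×
  ((a ≡ v × b ≡ parent T v) ⊎ (a ≡ parent T v × b ≡ v)))

Anc : ∀ {n} → RTree n → Fin n → Fin n → Set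
Anc T ℓ v = ∃[ k ] (iter (parent T) k ℓ ≡ v × (∀ k' → k' < k → iter (parent T) k' ℓ ≢ root T))

record BTBG (n : ℕ) : Set where
  field
    ntrees   : ℕ
    tree     : Fin ntrees → RTree n
    extended : ∀ i → Extended (tree i)
    covers   : ∀ v → ∃[ i ] v ∈ verts (tree i)
    edgeDisjoint : ∀ i j → i ≢ j → ∀ a b → TreeEdge (tree i) a b → TreeEdge (tree j) a b → ⊥
    leafTwice : ∀ i v → IsLeaf (tree i) v →
      ∃[ j ] (j ≢ i × IsLeaf (tree j) v × (∀ l → IsLeaf (tree l) v → l ≡ i ⊎ l ≡ j))
    shareLeaf : ∀ i j → i ≢ j → ∀ v → v ∈ verts (tree i) → v ∈ verts (tree j) →
      IsLeaf (tree i) v × IsLeaf (tree j) v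
    shareOne : ∀ i j → i ≢ j → ∀ u v → u ∈ verts (tree i) → u ∈ verts (tree j) →
      v ∈ verts (tree i) → v ∈ verts (tree j) → u ≡ v
open BTBG public

module _ {n : ℕ} (H : BTBG n) where

  Roots : Subset n
  Roots = ⋃ (map (λ i → ⁅ root (tree H i) ⁆) (allFin (ntrees H)))

  nroots : ℕ
  nroots = ∣ Roots ∣

  Adjacent : Fin (ntrees H) → Fin (ntrees H) → Set
  Adjacent i j = i ≢ j × ∃[ ℓ ] (IsLeaf (tree H i) ℓ × IsLeaf (tree H j) ℓ)

  IsPseudoedge : Fin n → Fin n → Set
  IsPseudoedge a b = ∃[ i ] ∃[ j ] (Adjacent i j × root (tree H i) ≡ a × root (tree H j) ≡ b)

  IsPseudomatching : List (Fin n × Fin n) → Set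
  IsPseudomatching M = All (λ e → IsPseudoedge (proj₁ e) (proj₂ e)) M ×
    Unique (concatMap (λ e → proj₁ e ∷ proj₂ e ∷ []) M)

  PseudomatchingBetween : Subset n → Subset n → List (Fin n × Fin n) → Set
  PseudomatchingBetween U V M = IsPseudomatching M ×
    All (λ e → proj₁ e ∈ U × proj₂ e ∈ V) M

  -- (1) height ≤ log m / 4.9 + 3, i.e. 49 (h - 3) ≤ 10 log m, i.e. 2^(49 (h ∸ 3)) ≤ m^10
  -- (h = number of vertices on a root–leaf path = depth + 1)
  HeightCond : Set
  HeightCond = ∀ i v → v ∈ verts (tree H i) →
    ∃[ k ] (iter (parent (tree H i)) k v ≡ root (tree H i) ×
            2 ^ (49 * (suc k ∸ 3)) ≤ nroots ^ 10)

  -- (2) |U|,|V| ≥ m^0.999 ⇒ pseudomatching of size ≥ m^0.999 / 3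
  ExpansionCond : Set
  ExpansionCond = ∀ U V → U ⊆ Roots → V ⊆ Roots → (∀ x → x ∈ U → x ∉ V) →
    nroots ^ 999 ≤ ∣ U ∣ ^ 1000 → nroots ^ 999 ≤ ∣ V ∣ ^ 1000 →
    ∃[ M ] (PseudomatchingBetween U V M × nroots ^ 999 ≤ (3 * length M) ^ 1000)

  Pseudoexpander : Set
  Pseudoexpander = HeightCond × ExpansionCond

  -- the Boolean function φ_H (on assignments S : Fin n → Bool), clause C_{i,j}
  -- consisting of the vertices of the path t_i → ℓ_{i,j} → t_j
  Phi : (Fin n → Bool) → Set
  Phi S = ∀ i j ℓ → i ≢ j → IsLeaf (tree H i) ℓ → IsLeaf (tree H j) ℓ →
    ∃[ v ] ((Anc (tree H i) ℓ v ⊎ Anc (tree H j) ℓ v) × S v ≡ true)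

-- Non-deterministic branching programs over variables Fin n.
-- A literal (x , true) is x, (x , false) is ¬x.

Lit : ℕ → Set
Lit n = Fin n × Bool

data Path {N E : ℕ} (src tgt : Fin E → Fin N) : Fin N → Fin N → Set where
  nil  : ∀ {v} → Path src tgt v v
  cons : ∀ {w} (e : Fin E) → Path src tgt (tgt e) w → Path src tgt (src e) w

labelsOf : ∀ {n N E : ℕ} {src tgt : Fin E → Fin N} → (Fin E → Maybe (Lit n)) →
  ∀ {u w} → Path src tgt u w → List (Lit n)
labelsOf lab nil = []
labelsOf lab (cons e p) with lab e
... | just l  = l ∷ labelsOf lab p
... | nothing = labelsOf lab p

record NBP (n : ℕ) : Set where
  field
    size   : ℕ
    nedges : ℕ
    src    : Fin nedges → Fin size
    tgt    : Fin nedges → Fin size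
    label  : Fin nedges → Maybe (Lit n)
    source : Fin size
    sink   : Fin size
    acyclic    : ∀ e → Path src tgt (tgt e) (src e) → ⊥
    uniqueSource : ∀ v → (∀ e → tgt e ≢ v) ⇔ (v ≡ source)
    uniqueSink   : ∀ v → (∀ e → src e ≢ v) ⇔ (v ≡ sink)
open NBP public

module _ {n : ℕ} (Z : NBP n) where

  SSPath : Set
  SSPath = Path (src Z) (tgt Z) (source Z) (sink Z)

  A : SSPath → List (Lit n)
  A P = labelsOf (label Z) P

  Computational : SSPath → Set
  Computational P = ∀ x → ¬ ((x , true) LM.∈ A P × (x , false) LM.∈ A P)

  Computes : ((Fin n → Bool) → Set) → Set
  Computes f = ∀ (S : Fin n → Bool) →
    f S ⇔ (∃[ P ] (Computational P × All (λ l → S (proj₁ l) ≡ proj₂ l) (A P)))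

  IsDNBP : ℕ → Set
  IsDNBP d = ∀ (P : SSPath) (x : Fin n) → length (filter (λ l → proj₁ l ≟ᶠ x) (A P)) ≤ d

-- N ≥ (p/q)^(n^(a/b)), expressed through all rationals u/v ≤ n^(a/b)
PowBound : ℕ → ℕ → ℕ → ℕ → ℕ → ℕ → Set
PowBound p q a b n N = ∀ u v → 0 < v → u ^ b ≤ n ^ a * v ^ b → p ^ u ≤ N ^ v * q ^ u

-- Write m for the number of roots.  By the height condition n ≤ m²(m + 3), hence 2^d is a tiny power of m.
--
-- A path of the program is cut into O(d²) blocks such that few roots are read on any path between the
-- end points of a block, and the blocks are two-coloured so that, for the roots u, v of a large set U × V,
-- u is read in blocks of the first colour only and v in blocks of the second colour only.  The end points
-- and colours form the trace of the path: two paths with a common trace can be spliced along the colours.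
--
-- Fix a list K of pseudoedges with pairwise distinct ends, and for x ∈ {0,1}^K set the ends of the e-th edge
-- to x_e and 1 - x_e, the other leaves to 1 and everything else (including the leaves of K) to 0.  This
-- satisfies φ_H.  If x ≠ x' have a common trace and differ only on edges of K with ends in U and V, splicing
-- their paths falsifies a clause; hence a trace serves at most 2^(|K| - h) points x, where h counts
-- the edges of K between its U and V.
--
-- If there are few traces, K can be chosen so that these numbers add up to less than 2^|K|.  It is chosen
-- greedily: with traces weighted by 2^(|K| - h), dependent random choice finds two traces with
-- A = U₁ ∩ U₂ and B = V₁ ∩ V₂ large and, after a small deletion, every pair of A × B lying in U × V for a
-- substantial fraction of the total weight; the expansion condition provides a pseudoedge between A and B.

module Submission where

open import Defs
open import Data.Nat hiding (_≟_)
open import Data.Nat.Properties hiding (_≟_; suc-injective)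
open import Data.Nat.DivMod using (m≡m%n+[m/n]*n; m%n<n)
open import Data.Nat.Tactic.RingSolver using (solve-∀)
open import Data.Fin using (Fin; zero; suc; _≟_; combine; fromℕ<)
open import Data.Fin.Properties using (any?; combine-injective; fromℕ<-injective; injective⇒≤; suc-injective)
open import Data.Fin.Subset using (Subset; _∈_; _∉_; _⊆_; ⁅_⁆; ⋃; ∣_∣)
open import Data.Fin.Subset.Properties using (_∈?_; x∈⁅x⁆; p⊆p∪q; q⊆p∪q)
open import Data.Bool as Bool using (Bool; true; false; _∧_; _∨_; not; if_then_else_; T)
open import Data.Bool.ListAction using (all)
open import Data.Bool.Properties using (T?; ∧-zeroʳ)
open import Data.Maybe as Maybe using (Maybe; just; nothing)
import Data.Maybe.Properties as Maybe
open import Data.List as List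
  using (List; []; _∷_; length; filter; filterᵇ; _++_; map; allFin; cartesianProductWith; cartesianProduct)
open import Data.List.Properties as List using (filter-++; length-++; length-map; length-filter; length-tabulate)
import Data.List.Membership.Propositional as LM
open import Data.List.Membership.Propositional.Properties
  using (∈-filter⁺; ∈-filter⁻; ∈-length; ∈-allFin; ∈-cartesianProductWith⁺; ∈-cartesianProduct⁺; ∈-map⁺)
open import Data.List.Relation.Unary.Any using (here; there)
open import Data.List.Relation.Unary.All as All using (All; []; _∷_)
open import Data.List.Relation.Unary.All.Properties using (++⁺; ++⁻)
open import Data.List.Relation.Unary.AllPairs using ([]; _∷_)
open import Data.List.Relation.Unary.Unique.Propositional using (Unique)
import Data.List.Relation.Unary.Unique.Propositional.Properties as Unique
open import Data.Vec as Vec using (Vec; []; _∷_; lookup)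
open import Data.Vec.Properties as Vec using (lookup∘tabulate; []=⇒lookup; lookup⇒[]=)
open import Data.Product using (Σ; ∃-syntax; _×_; _,_; proj₁; proj₂)
open import Data.Product.Properties using () renaming (≡-dec to ×-≡-dec)
open import Data.Sum using (_⊎_; inj₁; inj₂)
open import Data.Empty using (⊥; ⊥-elim)
open import Data.Unit using (⊤; tt)
open import Function using (_∘_; id; Equivalence)
open import Relation.Nullary
open import Relation.Nullary.Decidable using (_×-dec_; map′; dec-true; ¬¬-excluded-middle)
open import Relation.Binary.Definitions using (DecidableEquality)
open import Relation.Binary.PropositionalEquality

private variable
  X Y : Set

-- Finite sums of natural numbers and the Cauchy-Schwarz inequality

𝟙 : Bool → ℕ
𝟙 true  = 1
𝟙 false = 0

∑ : List X → (X → ℕ) → ℕ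
∑ []       f = 0
∑ (x ∷ xs) f = f x + ∑ xs f

𝟙-∧ : ∀ b c → 𝟙 (b ∧ c) ≡ 𝟙 b * 𝟙 c
𝟙-∧ true  c = sym (+-identityʳ (𝟙 c))
𝟙-∧ false c = refl

𝟙≤1 : ∀ b → 𝟙 b ≤ 1
𝟙≤1 true  = ≤-refl
𝟙≤1 false = z≤n

∑-cong : ∀ (xs : List X) {f g : X → ℕ} → (∀ x → f x ≡ g x) → ∑ xs f ≡ ∑ xs g
∑-cong []       eq = refl
∑-cong (x ∷ xs) eq = cong₂ _+_ (eq x) (∑-cong xs eq)

∑-mono-∈ : ∀ (xs : List X) {f g : X → ℕ} → (∀ x → x LM.∈ xs → f x ≤ g x) → ∑ xs f ≤ ∑ xs g
∑-mono-∈ []       le = z≤n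
∑-mono-∈ (x ∷ xs) le = +-mono-≤ (le x (here refl)) (∑-mono-∈ xs (λ y y∈ → le y (there y∈)))

∑-mono : ∀ (xs : List X) {f g : X → ℕ} → (∀ x → f x ≤ g x) → ∑ xs f ≤ ∑ xs g
∑-mono xs le = ∑-mono-∈ xs (λ x _ → le x)

interchange : ∀ a b c d → (a + b) + (c + d) ≡ (a + c) + (b + d)
interchange = solve-∀

∑-+ : ∀ (xs : List X) (f g : X → ℕ) → ∑ xs (λ x → f x + g x) ≡ ∑ xs f + ∑ xs g
∑-+ []       f g = refl
∑-+ (x ∷ xs) f g rewrite ∑-+ xs f g = interchange (f x) (g x) (∑ xs f) (∑ xs g)

∑-*ˡ : ∀ (xs : List X) c (f : X → ℕ) → ∑ xs (λ x → c * f x) ≡ c * ∑ xs f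
∑-*ˡ []       c f = sym (*-zeroʳ c)
∑-*ˡ (x ∷ xs) c f rewrite ∑-*ˡ xs c f = sym (*-distribˡ-+ c (f x) (∑ xs f))

∑-*ʳ : ∀ (xs : List X) c (f : X → ℕ) → ∑ xs (λ x → f x * c) ≡ ∑ xs f * c
∑-*ʳ []       c f = refl
∑-*ʳ (x ∷ xs) c f rewrite ∑-*ʳ xs c f = sym (*-distribʳ-+ c (f x) (∑ xs f))

∑-const : ∀ (xs : List X) c → ∑ xs (λ _ → c) ≡ length xs * c
∑-const []       c = refl
∑-const (x ∷ xs) c = cong (c +_) (∑-const xs c)

∑-1 : ∀ (xs : List X) → ∑ xs (λ _ → 1) ≡ length xs
∑-1 xs = trans (∑-const xs 1) (*-identityʳ _)

∑-0 : ∀ (xs : List X) → ∑ xs (λ _ → 0) ≡ 0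
∑-0 xs = trans (∑-const xs 0) (*-zeroʳ (length xs))

∑-swap : ∀ (xs : List X) (ys : List Y) (f : X → Y → ℕ) →
  ∑ xs (λ x → ∑ ys (f x)) ≡ ∑ ys (λ y → ∑ xs (λ x → f x y))
∑-swap []       ys f = sym (∑-0 ys)
∑-swap (x ∷ xs) ys f rewrite ∑-swap xs ys f = sym (∑-+ ys (f x) (λ y → ∑ xs (λ x → f x y)))

∑-*-∑ : ∀ (xs : List X) (ys : List Y) (f : X → ℕ) (g : Y → ℕ) →
  ∑ xs (λ x → ∑ ys (λ y → f x * g y)) ≡ ∑ xs f * ∑ ys g
∑-*-∑ xs ys f g = trans (∑-cong xs (λ x → ∑-*ˡ ys (f x) g)) (∑-*ʳ xs (∑ ys g) f)

∑-++ : ∀ (xs ys : List X) (f : X → ℕ) → ∑ (xs ++ ys) f ≡ ∑ xs f + ∑ ys f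
∑-++ []       ys f = refl
∑-++ (x ∷ xs) ys f = trans (cong (f x +_) (∑-++ xs ys f)) (sym (+-assoc (f x) _ _))

≤∑ : ∀ {xs : List X} {x} (f : X → ℕ) → x LM.∈ xs → f x ≤ ∑ xs f
≤∑ {xs = x ∷ xs} f (here refl) = m≤m+n _ _
≤∑ {xs = x ∷ xs} f (there x∈)  = ≤-trans (≤∑ f x∈) (m≤n+m _ _)

∑-filterᵇ : ∀ (p : X → Bool) (xs : List X) (f : X → ℕ) →
  ∑ (filterᵇ p xs) f ≡ ∑ xs (λ x → 𝟙 (p x) * f x)
∑-filterᵇ p []       f = refl
∑-filterᵇ p (x ∷ xs) f with p x
... | true  = cong₂ _+_ (sym (+-identityʳ (f x))) (∑-filterᵇ p xs f)
... | false = ∑-filterᵇ p xs f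

∑≤length : ∀ (xs : List X) (p : X → Bool) → ∑ xs (λ x → 𝟙 (p x)) ≤ length xs
∑≤length xs p = ≤-trans (∑-mono xs (λ x → 𝟙≤1 (p x))) (≤-reflexive (∑-1 xs))

2ab≤a²+b² : ∀ a b → 2 * a * b ≤ a * a + b * b
2ab≤a²+b² a b with ≤-total a b
... | inj₁ a≤b rewrite sym (m+[n∸m]≡n a≤b) = lem a (b ∸ a)
  where
  lem : ∀ a k → 2 * a * (a + k) ≤ a * a + (a + k) * (a + k)
  lem a k = ≤-trans (m≤m+n _ (k * k)) (≤-reflexive (eq a k))
    where eq : ∀ a k → 2 * a * (a + k) + k * k ≡ a * a + (a + k) * (a + k)
          eq = solve-∀
... | inj₂ b≤a rewrite sym (m+[n∸m]≡n b≤a) = lem b (a ∸ b)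
  where
  lem : ∀ b k → 2 * (b + k) * b ≤ (b + k) * (b + k) + b * b
  lem b k = ≤-trans (m≤m+n _ (k * k)) (≤-reflexive (eq b k))
    where eq : ∀ b k → 2 * (b + k) * b + k * k ≡ (b + k) * (b + k) + b * b
          eq = solve-∀

cauchy-schwarz : ∀ (xs : List X) (f : X → ℕ) →
  ∑ xs f * ∑ xs f ≤ length xs * ∑ xs (λ x → f x * f x)
cauchy-schwarz []       f = z≤n
cauchy-schwarz (x ∷ xs) f = begin
  (a + S) * (a + S)                       ≡⟨ e₁ a S ⟩
  a * a + 2 * a * S + S * S               ≤⟨ +-mono-≤ (+-monoʳ-≤ (a * a) cross) (cauchy-schwarz xs f) ⟩
  a * a + (ℓ * (a * a) + S₂) + ℓ * S₂     ≡⟨ e₂ (a * a) ℓ S₂ ⟩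
  (1 + ℓ) * (a * a + S₂)                  ∎
  where
  open ≤-Reasoning
  a = f x
  S = ∑ xs f
  S₂ = ∑ xs (λ x → f x * f x)
  ℓ = length xs
  e₁ : ∀ a S → (a + S) * (a + S) ≡ a * a + 2 * a * S + S * S
  e₁ = solve-∀
  e₂ : ∀ A ℓ S → A + (ℓ * A + S) + ℓ * S ≡ (1 + ℓ) * (A + S)
  e₂ = solve-∀
  cross : 2 * a * S ≤ ℓ * (a * a) + S₂
  cross = begin
    2 * a * S                            ≡⟨ ∑-*ˡ xs (2 * a) f ⟨
    ∑ xs (λ y → 2 * a * f y)             ≤⟨ ∑-mono xs (λ y → 2ab≤a²+b² a (f y)) ⟩
    ∑ xs (λ y → a * a + f y * f y)       ≡⟨ ∑-+ xs (λ _ → a * a) (λ y → f y * f y) ⟩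
    ∑ xs (λ _ → a * a) + S₂              ≡⟨ cong (_+ S₂) (∑-const xs (a * a)) ⟩
    ℓ * (a * a) + S₂                     ∎

cauchy-schwarz₂ : ∀ (xs : List X) (ys : List Y) (f : X → Y → ℕ) →
  ∑ xs (λ x → ∑ ys (f x)) * ∑ xs (λ x → ∑ ys (f x)) ≤
  (length xs * length ys) * ∑ xs (λ x → ∑ ys (λ y → f x y * f x y))
cauchy-schwarz₂ xs ys f = begin
  ∑ xs (λ x → ∑ ys (f x)) * ∑ xs (λ x → ∑ ys (f x))
    ≤⟨ cauchy-schwarz xs _ ⟩
  length xs * ∑ xs (λ x → ∑ ys (f x) * ∑ ys (f x))
    ≤⟨ *-monoʳ-≤ (length xs) (∑-mono xs (λ x → cauchy-schwarz ys (f x))) ⟩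
  length xs * ∑ xs (λ x → length ys * ∑ ys (λ y → f x y * f x y))
    ≡⟨ cong (length xs *_) (∑-*ˡ xs (length ys) _) ⟩
  length xs * (length ys * ∑ xs (λ x → ∑ ys (λ y → f x y * f x y)))
    ≡⟨ *-assoc (length xs) (length ys) _ ⟨
  (length xs * length ys) * ∑ xs (λ x → ∑ ys (λ y → f x y * f x y)) ∎
  where open ≤-Reasoning

-- Two-colouring blocks by the method of conditional expectations

module Colouring {B X : Set} (occ : B → X → Bool) where

  occs : List B → X → ℕ
  occs bs u = ∑ bs (λ b → 𝟙 (occ b u))

  -- The set U of a coloured list is given by `avoids false` (its elements occur in blocks of colour
  -- `true` only), the set V by `avoids true`.
  avoids : Bool → List (B × Bool) → X → Bool
  avoids c     []                 v = true
  avoids false ((b , true) ∷ tr)  v = avoids false tr v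
  avoids false ((b , false) ∷ tr) v = not (occ b v) ∧ avoids false tr v
  avoids true  ((b , true) ∷ tr)  v = not (occ b v) ∧ avoids true tr v
  avoids true  ((b , false) ∷ tr) v = avoids true tr v

  -- Update of the weight of a pair when one block is coloured. Doubling pays for the factor 2 that
  -- `total` loses when the block leaves the list of blocks still to be coloured.
  gain : Bool → Bool → ℕ → ℕ
  gain doubled killed w = if killed then 0 else if doubled then 2 * w else w

  gain-0 : ∀ o k {w} → w ≡ 0 → gain o k w ≡ 0
  gain-0 true  true  refl = refl
  gain-0 false true  refl = refl
  gain-0 true  false refl = refl
  gain-0 false false refl = refl

  -- The two summands are the updated weights under the two colours, so the average does not drop. A
  -- block containing both elements kills the pair under either colour; hence the hypothesis.
  gain-sum : ∀ o k w → (o ≡ true → k ≡ true → w ≡ 0) → 2 * w ≤ gain o k w + gain k o w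
  gain-sum true  true  w h rewrite h refl refl = z≤n
  gain-sum true  false w h = m≤m+n (2 * w) 0
  gain-sum false true  w h = ≤-refl
  gain-sum false false w h = ≤-reflexive (cong (w +_) (+-identityʳ w))

  -- Under uniformly random colours a pair without a common block survives with probability 1 over
  -- `2 ^ (occs bs u + occs bs v)`. The power of two normalises this, so that the expected total is
  -- the original weight.
  total : List (B × Bool) → List B → (X → X → ℕ) → X → X → ℕ
  total tr bs w u v =
    𝟙 (avoids false tr u) * 𝟙 (avoids true tr v) * (w u v * 2 ^ (occs bs u + occs bs v))

  private
    shift : ∀ (a b w : ℕ) o o' → a * b * (2 * w * 2 ^ (o + o')) ≤ a * b * (w * 2 ^ (suc o + o'))
    shift a b w o o' = ≤-reflexive (cong (a * b *_) (lem w (2 ^ (o + o'))))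
      where lem : ∀ w p → 2 * w * p ≡ w * (2 * p)
            lem = solve-∀

    shift' : ∀ (a b w : ℕ) o o' → a * b * (2 * w * 2 ^ (o + o')) ≤ a * b * (w * 2 ^ (o + suc o'))
    shift' a b w o o' rewrite +-suc o o' = shift a b w o o'

  total-true : ∀ b tr bs w u v →
    total tr bs (λ u v → gain (occ b u) (occ b v) (w u v)) u v ≤ total ((b , true) ∷ tr) (b ∷ bs) w u v
  total-true b tr bs w u v with occ b u | occ b v
  ... | o     | true  rewrite *-zeroʳ (𝟙 (avoids false tr u) * 𝟙 (avoids true tr v)) = z≤n
  ... | true  | false = shift (𝟙 (avoids false tr u)) (𝟙 (avoids true tr v)) (w u v) (occs bs u) (occs bs v)
  ... | false | false = ≤-refl

  total-false : ∀ b tr bs w u v →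
    total tr bs (λ u v → gain (occ b v) (occ b u) (w u v)) u v ≤ total ((b , false) ∷ tr) (b ∷ bs) w u v
  total-false b tr bs w u v with occ b u | occ b v
  ... | true  | k     rewrite *-zeroʳ (𝟙 (avoids false tr u) * 𝟙 (avoids true tr v)) = z≤n
  ... | false | true  = shift' (𝟙 (avoids false tr u)) (𝟙 (avoids true tr v)) (w u v) (occs bs u) (occs bs v)
  ... | false | false = ≤-refl

  -- One of the two colours of the first block keeps the updated weight at least as large as the old
  -- one; the other blocks are coloured by induction with the updated weight.
  colouring : ∀ (L R : List X) (bs : List B) (w : X → X → ℕ) →
    (∀ b → b LM.∈ bs → ∀ u v → occ b u ≡ true → occ b v ≡ true → w u v ≡ 0) →
    ∃[ tr ] (map proj₁ tr ≡ bs ×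
      ∑ L (λ u → ∑ R (λ v → w u v)) ≤ ∑ L (λ u → ∑ R (λ v → total tr bs w u v)))
  colouring L R [] w h = [] , refl ,
    ∑-mono L (λ u → ∑-mono R (λ v → ≤-reflexive (lem (w u v))))
    where lem : ∀ w → w ≡ 1 * 1 * (w * 1)
          lem = solve-∀
  colouring L R (b ∷ bs) w h = pick (≤-total (2 * S) (2 * S₁))
    where
    w₁ w₀ : X → X → ℕ
    w₁ u v = gain (occ b u) (occ b v) (w u v)
    w₀ u v = gain (occ b v) (occ b u) (w u v)
    S  = ∑ L (λ u → ∑ R (λ v → w u v))
    S₁ = ∑ L (λ u → ∑ R (λ v → w₁ u v))
    S₀ = ∑ L (λ u → ∑ R (λ v → w₀ u v))

    split : 2 * S ≤ S₁ + S₀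
    split = begin
      2 * S                                       ≡⟨ ∑-*ˡ L 2 _ ⟨
      ∑ L (λ u → 2 * ∑ R (λ v → w u v))           ≡⟨ ∑-cong L (λ u → ∑-*ˡ R 2 (w u)) ⟨
      ∑ L (λ u → ∑ R (λ v → 2 * w u v))
        ≤⟨ ∑-mono L (λ u → ∑-mono R (λ v → gain-sum (occ b u) (occ b v) (w u v) (h b (here refl) u v))) ⟩
      ∑ L (λ u → ∑ R (λ v → w₁ u v + w₀ u v))     ≡⟨ ∑-cong L (λ u → ∑-+ R (w₁ u) (w₀ u)) ⟩
      ∑ L (λ u → ∑ R (w₁ u) + ∑ R (w₀ u))         ≡⟨ ∑-+ L _ _ ⟩
      S₁ + S₀                                     ∎
      where open ≤-Reasoning

    pick : 2 * S ≤ 2 * S₁ ⊎ 2 * S₁ ≤ 2 * S → _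
    pick (inj₁ le) with colouring L R bs w₁ (λ b' b'∈ u v p q → gain-0 (occ b u) (occ b v) (h b' (there b'∈) u v p q))
    ... | tr , eq , bound = (b , true) ∷ tr , cong (b ∷_) eq ,
      ≤-trans (*-cancelˡ-≤ 2 le) (≤-trans bound
        (∑-mono L (λ u → ∑-mono R (λ v → total-true b tr bs w u v))))
    pick (inj₂ ge) with colouring L R bs w₀ (λ b' b'∈ u v p q → gain-0 (occ b v) (occ b u) (h b' (there b'∈) u v p q))
    ... | tr , eq , bound = (b , false) ∷ tr , cong (b ∷_) eq ,
      ≤-trans S≤S₀ (≤-trans bound
        (∑-mono L (λ u → ∑-mono R (λ v → total-false b tr bs w u v))))
      where
      S≤S₀ : S ≤ S₀
      S≤S₀ = +-cancelˡ-≤ S S S₀ (≤-trans (≤-reflexive (cong (S +_) (sym (+-identityʳ S))))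
               (≤-trans split (+-monoˡ-≤ S₀ (*-cancelˡ-≤ 2 ge))))

-- Subsets of the Boolean cube separated by a set of coordinates

∑𝔹 : ∀ k → (Vec Bool k → ℕ) → ℕ
∑𝔹 zero    f = f []
∑𝔹 (suc k) f = ∑𝔹 k (λ x → f (false ∷ x)) + ∑𝔹 k (λ x → f (true ∷ x))

∑𝔹-mono : ∀ k {f g : Vec Bool k → ℕ} → (∀ x → f x ≤ g x) → ∑𝔹 k f ≤ ∑𝔹 k g
∑𝔹-mono zero    le = le []
∑𝔹-mono (suc k) le = +-mono-≤ (∑𝔹-mono k (λ x → le (false ∷ x))) (∑𝔹-mono k (λ x → le (true ∷ x)))

∑𝔹-+ : ∀ k (f g : Vec Bool k → ℕ) → ∑𝔹 k (λ x → f x + g x) ≡ ∑𝔹 k f + ∑𝔹 k g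
∑𝔹-+ zero    f g = refl
∑𝔹-+ (suc k) f g
  rewrite ∑𝔹-+ k (λ x → f (false ∷ x)) (λ x → g (false ∷ x))
        | ∑𝔹-+ k (λ x → f (true ∷ x)) (λ x → g (true ∷ x))
  = interchange (∑𝔹 k (λ x → f (false ∷ x))) _ _ _

∑𝔹-1 : ∀ k → ∑𝔹 k (λ _ → 1) ≡ 2 ^ k
∑𝔹-1 zero    = refl
∑𝔹-1 (suc k) rewrite ∑𝔹-1 k = cong (2 ^ k +_) (sym (+-identityʳ (2 ^ k)))

∑𝔹-0 : ∀ k → ∑𝔹 k (λ _ → 0) ≡ 0
∑𝔹-0 zero    = refl
∑𝔹-0 (suc k) rewrite ∑𝔹-0 k = refl

∑𝔹-∑-swap : ∀ {A : Set} k (xs : List A) (f : Vec Bool k → A → ℕ) →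
  ∑𝔹 k (λ x → ∑ xs (f x)) ≡ ∑ xs (λ a → ∑𝔹 k (λ x → f x a))
∑𝔹-∑-swap k []       f = ∑𝔹-0 k
∑𝔹-∑-swap k (a ∷ xs) f =
  trans (∑𝔹-+ k (λ x → f x a) (λ x → ∑ xs (f x))) (cong (∑𝔹 k (λ x → f x a) +_) (∑𝔹-∑-swap k xs f))

AgreeOff : ∀ {k} → Vec Bool k → Vec Bool k → Vec Bool k → Set
AgreeOff []       []      []        = ⊤
AgreeOff (h ∷ hs) (b ∷ x) (b' ∷ x') = (h ≡ false → b ≡ b') × AgreeOff hs x x'

agreeOff-refl : ∀ {k} (h x : Vec Bool k) → AgreeOff h x x
agreeOff-refl []      []      = tt
agreeOff-refl (_ ∷ h) (_ ∷ x) = (λ _ → refl) , agreeOff-refl h x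

-- Two to the number of `false` entries: the size of the cube after forgetting the marked
-- coordinates.
cube : ∀ {k} → Vec Bool k → ℕ
cube []          = 1
cube (true ∷ h)  = cube h
cube (false ∷ h) = 2 * cube h

Separated : ∀ {k} → Vec Bool k → (Vec Bool k → Bool) → Set
Separated h F = ∀ x x' → F x ≡ true → F x' ≡ true → AgreeOff h x x' → x ≡ x'

∷-tail : ∀ {k} {b b'} {x x' : Vec Bool k} → b Vec.∷ x ≡ b' ∷ x' → x ≡ x'
∷-tail refl = refl

-- Forgetting the marked coordinates is injective on `F`. In the induction a marked coordinate
-- merges the two halves of `F` by disjunction; separation makes them disjoint.
separated-count : ∀ {k} (h : Vec Bool k) (F : Vec Bool k → Bool) → Separated h F →
  ∑𝔹 k (λ x → 𝟙 (F x)) ≤ cube h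
separated-count []          F sep = 𝟙≤1 (F [])
separated-count (false ∷ h) F sep = ≤-trans (+-mono-≤ (half false) (half true))
  (≤-reflexive (cong (cube h +_) (sym (+-identityʳ _))))
  where
  half : ∀ b → ∑𝔹 _ (λ x → 𝟙 (F (b ∷ x))) ≤ cube h
  half b = separated-count h (λ x → F (b ∷ x)) λ x x' p q ag → ∷-tail (sep _ _ p q ((λ _ → refl) , ag))
separated-count {suc k} (true ∷ h)  F sep =
  ≤-trans (≤-reflexive (sym (∑𝔹-+ k _ _))) (≤-trans (∑𝔹-mono k disj) (separated-count h F' sep'))
  where
  F' : Vec Bool k → Bool
  F' x = F (false ∷ x) ∨ F (true ∷ x)
  disj : ∀ x → 𝟙 (F (false ∷ x)) + 𝟙 (F (true ∷ x)) ≤ 𝟙 (F' x)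
  disj x with F (false ∷ x) in p | F (true ∷ x) in q
  ... | false | _     = ≤-refl
  ... | true  | false = ≤-refl
  ... | true  | true  with sep _ _ p q ((λ ()) , agreeOff-refl h x)
  ... | ()
  sep' : Separated h F'
  sep' x x' p q ag with F (false ∷ x) in p₀ | F (true ∷ x) in p₁ | F (false ∷ x') in q₀ | F (true ∷ x') in q₁
  ... | true  | _    | true  | _    = ∷-tail (sep _ _ p₀ q₀ ((λ ()) , ag))
  ... | true  | _    | false | true = ∷-tail (sep _ _ p₀ q₁ ((λ ()) , ag))
  ... | false | true | true  | _    = ∷-tail (sep _ _ p₁ q₀ ((λ ()) , ag))
  ... | false | true | false | true = ∷-tail (sep _ _ p₁ q₁ ((λ ()) , ag))

-- Dependent random choice for weighted families of rectangles

search : ∀ {A : Set} {P : A → Set} → (∀ x → Dec (P x)) → ∀ xs →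
  (∃[ x ] (x LM.∈ xs × P x)) ⊎ (∀ x → x LM.∈ xs → ¬ P x)
search P? []       = inj₂ λ _ ()
search P? (x ∷ xs) with P? x
... | yes p = inj₁ (x , here refl , p)
... | no ¬p with search P? xs
...   | inj₁ (y , y∈ , p) = inj₁ (y , there y∈ , p)
...   | inj₂ none = inj₂ λ { y (here refl) → ¬p ; y (there y∈) → none y y∈ }

∑-rotate : ∀ {A B C : Set} (xs : List A) (ys : List B) (zs : List C) (f : A → B → C → ℕ) →
  ∑ xs (λ x → ∑ ys (λ y → ∑ zs (f x y))) ≡ ∑ zs (λ z → ∑ xs (λ x → ∑ ys (λ y → f x y z)))
∑-rotate xs ys zs f = trans (∑-cong xs (λ x → ∑-swap ys zs (f x))) (∑-swap xs zs _)

none-or-some : ∀ {X : Set} (p : X → Bool) (xs : List X) →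
  1 ≤ 𝟙 (all (λ x → not (p x)) xs) + ∑ xs (λ x → 𝟙 (p x))
none-or-some p []       = ≤-refl
none-or-some p (x ∷ xs) with p x
... | true  = s≤s z≤n
... | false = none-or-some p xs

all-not : ∀ {X : Set} (p : X → Bool) (xs : List X) → all (λ x → not (p x)) xs ≡ true →
  ∀ {x} → x LM.∈ xs → p x ≡ false
all-not p (x ∷ xs) eq x∈ with p x in px
all-not p (x ∷ xs) () x∈           | true
all-not p (x ∷ xs) eq (here refl) | false = px
all-not p (x ∷ xs) eq (there x∈)  | false = all-not p xs eq x∈

∧-true : ∀ {a b} → a ∧ b ≡ true → a ≡ true × b ≡ true
∧-true {true} {true} refl = refl , refl

<ᵇ-false : ∀ {a b} → (a <ᵇ b) ≡ false → b ≤ a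
<ᵇ-false {a} {b} eq = ≮⇒≥ λ lt → subst T eq (<⇒<ᵇ lt)

module Choice {I X : Set} (Ω : List I) (w : I → ℕ) (U V : I → X → Bool) (L R : List X)
  (m D Q : ℕ) (L≤ : length L ≤ m) (R≤ : length R ≤ m) (m>0 : 0 < m)
  (dense : ∀ α → α LM.∈ Ω → m * m ≤ D * (∑ L (λ a → 𝟙 (U α a)) * ∑ R (λ b → 𝟙 (V α b))))
  (Q-large : 2 * (D * D) * m ≤ Q * Q) (W>0 : 0 < ∑ Ω w) where

  W M C : ℕ
  W = ∑ Ω w
  M = m * m
  C = 2 * (D * D)

  t : I → X → X → ℕ
  t α a b = w α * (𝟙 (U α a) * 𝟙 (V α b))

  -- Divided by `W`, this is the probability that the rectangle of a random member of `Ω`, drawn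
  -- with weight `w`, contains the pair.
  π : X → X → ℕ
  π a b = ∑ Ω (λ α → t α a b)

  rare : X → X → Bool
  rare a b = Q * π a b <ᵇ W

  U₂ V₂ : I → I → X → Bool
  U₂ α β a = U α a ∧ U β a
  V₂ α β b = V α b ∧ V β b

  pairs : (X → X → ℕ) → I → I → ℕ
  pairs c α β = ∑ L (λ a → ∑ R (λ b → c a b * (𝟙 (U₂ α β a) * 𝟙 (V₂ α β b))))

  one rareᵢ : X → X → ℕ
  one _ _ = 1
  rareᵢ a b = 𝟙 (rare a b)

  -- Expanding the square turns a sum over pairs of elements into one over pairs of rectangles; `U₂`
  -- and `V₂` are the sides of the intersection of two rectangles.
  second-moment : ∀ c →
    ∑ L (λ a → ∑ R (λ b → c a b * (π a b * π a b))) ≡ ∑ Ω (λ α → ∑ Ω (λ β → w α * w β * pairs c α β))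
  second-moment c = begin
    ∑ L (λ a → ∑ R (λ b → c a b * (π a b * π a b)))
      ≡⟨ ∑-cong L (λ a → ∑-cong R (λ b → trans (cong (c a b *_) (sym (∑-*-∑ Ω Ω (λ α → t α a b) (λ α → t α a b))))
           (trans (sym (∑-*ˡ Ω (c a b) _)) (∑-cong Ω (λ α → sym (∑-*ˡ Ω (c a b) _)))))) ⟩
    ∑ L (λ a → ∑ R (λ b → ∑ Ω (λ α → ∑ Ω (λ β → c a b * (t α a b * t β a b)))))
      ≡⟨ ∑-rotate L R Ω _ ⟩
    ∑ Ω (λ α → ∑ L (λ a → ∑ R (λ b → ∑ Ω (λ β → c a b * (t α a b * t β a b)))))
      ≡⟨ ∑-cong Ω (λ α → ∑-rotate L R Ω _) ⟩
    ∑ Ω (λ α → ∑ Ω (λ β → ∑ L (λ a → ∑ R (λ b → c a b * (t α a b * t β a b)))))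
      ≡⟨ ∑-cong Ω (λ α → ∑-cong Ω (λ β → trans
           (∑-cong L (λ a → trans (∑-cong R (λ b → point α β a b)) (∑-*ˡ R (w α * w β) _)))
           (∑-*ˡ L (w α * w β) _))) ⟩
    ∑ Ω (λ α → ∑ Ω (λ β → w α * w β * pairs c α β)) ∎
    where
    open ≡-Reasoning
    ring : ∀ c w u v w' u' v' → c * ((w * (u * v)) * (w' * (u' * v'))) ≡ w * w' * (c * ((u * u') * (v * v')))
    ring = solve-∀
    point : ∀ α β a b → c a b * (t α a b * t β a b) ≡ w α * w β * (c a b * (𝟙 (U₂ α β a) * 𝟙 (V₂ α β b)))
    point α β a b rewrite 𝟙-∧ (U α a) (U β a) | 𝟙-∧ (V α b) (V β b) =
      ring (c a b) (w α) (𝟙 (U α a)) (𝟙 (V α b)) (w β) (𝟙 (U β a)) (𝟙 (V β b))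

  Σπ Σπ² Σrare : ℕ
  Σπ    = ∑ L (λ a → ∑ R (λ b → π a b))
  Σπ²   = ∑ L (λ a → ∑ R (λ b → π a b * π a b))
  Σrare = ∑ L (λ a → ∑ R (λ b → rareᵢ a b * (π a b * π a b)))

  first-moment : M * W ≤ D * Σπ
  first-moment = begin
    M * W                                    ≡⟨ ∑-*ˡ Ω M w ⟨
    ∑ Ω (λ α → M * w α)                      ≤⟨ ∑-mono-∈ Ω step ⟩
    ∑ Ω (λ α → D * ∑ L (λ a → ∑ R (λ b → t α a b)))  ≡⟨ ∑-*ˡ Ω D _ ⟩
    D * ∑ Ω (λ α → ∑ L (λ a → ∑ R (λ b → t α a b)))  ≡⟨ cong (D *_) (∑-rotate L R Ω (λ a b α → t α a b)) ⟨
    D * Σπ                                   ∎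
    where
    open ≤-Reasoning
    ring : ∀ D x w → D * x * w ≡ D * (w * x)
    ring = solve-∀
    step : ∀ α → α LM.∈ Ω → M * w α ≤ D * ∑ L (λ a → ∑ R (λ b → t α a b))
    step α α∈ = begin
      M * w α   ≤⟨ *-monoˡ-≤ (w α) (dense α α∈) ⟩
      D * (∑ L (λ a → 𝟙 (U α a)) * ∑ R (λ b → 𝟙 (V α b))) * w α   ≡⟨ ring D _ (w α) ⟩
      D * (w α * (∑ L (λ a → 𝟙 (U α a)) * ∑ R (λ b → 𝟙 (V α b))))
        ≡⟨ cong (λ z → D * (w α * z)) (∑-*-∑ L R _ _) ⟨
      D * (w α * ∑ L (λ a → ∑ R (λ b → 𝟙 (U α a) * 𝟙 (V α b))))
        ≡⟨ cong (D *_) (trans (∑-cong L (λ a → ∑-*ˡ R (w α) _)) (∑-*ˡ L (w α) _)) ⟨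
      D * ∑ L (λ a → ∑ R (λ b → t α a b)) ∎

  M>0 : NonZero M
  M>0 = >-nonZero (*-mono-≤ m>0 m>0)

  -- Cauchy-Schwarz over the at most `M` pairs, applied to the first moment.
  many : M * (W * W) ≤ D * D * Σπ²
  many = *-cancelˡ-≤ M {{M>0}} (begin
    M * (M * (W * W))        ≡⟨ r₁ M W ⟩
    (M * W) * (M * W)        ≤⟨ *-mono-≤ first-moment first-moment ⟩
    (D * Σπ) * (D * Σπ)      ≡⟨ r₂ D Σπ ⟩
    D * D * (Σπ * Σπ)        ≤⟨ *-monoʳ-≤ (D * D) (≤-trans (cauchy-schwarz₂ L R π)
                                 (*-monoˡ-≤ Σπ² (*-mono-≤ L≤ R≤))) ⟩
    D * D * (M * Σπ²)        ≡⟨ r₃ (D * D) M Σπ² ⟩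
    M * (D * D * Σπ²)        ∎)
    where
    open ≤-Reasoning
    r₁ : ∀ M W → M * (M * (W * W)) ≡ (M * W) * (M * W)
    r₁ = solve-∀
    r₂ : ∀ D S → (D * S) * (D * S) ≡ D * D * (S * S)
    r₂ = solve-∀
    r₃ : ∀ D M S → D * (M * S) ≡ M * (D * S)
    r₃ = solve-∀

  few : Q * Q * Σrare ≤ M * (W * W)
  few = begin
    Q * Q * Σrare
      ≡⟨ trans (∑-cong L (λ a → ∑-*ˡ R (Q * Q) _)) (∑-*ˡ L (Q * Q) _) ⟨
    ∑ L (λ a → ∑ R (λ b → Q * Q * (rareᵢ a b * (π a b * π a b))))
      ≤⟨ ∑-mono L (λ a → ∑-mono R (λ b → point a b)) ⟩
    ∑ L (λ a → ∑ R (λ b → W * W))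
      ≡⟨ trans (∑-cong L (λ a → ∑-const R (W * W))) (∑-const L (length R * (W * W))) ⟩
    length L * (length R * (W * W))   ≡⟨ *-assoc (length L) (length R) (W * W) ⟨
    length L * length R * (W * W)     ≤⟨ *-monoˡ-≤ (W * W) (*-mono-≤ L≤ R≤) ⟩
    M * (W * W) ∎
    where
    open ≤-Reasoning
    ring : ∀ Q p → Q * Q * (1 * (p * p)) ≡ (Q * p) * (Q * p)
    ring = solve-∀
    point : ∀ a b → Q * Q * (rareᵢ a b * (π a b * π a b)) ≤ W * W
    point a b with rare a b in eq
    ... | false = ≤-trans (≤-reflexive (*-zeroʳ (Q * Q))) z≤n
    ... | true  = ≤-trans (≤-reflexive (ring Q (π a b))) (*-mono-≤ lt lt)
      where lt = <⇒≤ (<ᵇ⇒< (Q * π a b) W (subst T (sym eq) _))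

  -- The intersection of the two rectangles exceeds `m` times its number of rare pairs by `M / C`,
  -- so one can afford to delete, for every rare pair, an element together with its at most `m`
  -- pairs.
  Good : I → I → Set
  Good α β = M + C * m * pairs rareᵢ α β ≤ C * pairs one α β

  -- If no pair were good, the opposite inequalities could be summed with weights `w α * w β`. By
  -- `many` the left side would exceed `2 * M * (W * W)`, strictly because `W` is positive, while
  -- `few` and `Q-large` bound the right side by the same number.
  good-pair : ∃[ α ] ∃[ β ] (α LM.∈ Ω × β LM.∈ Ω × Good α β)
  good-pair with search (λ α → dec α) Ω
    where
    dec : ∀ α → Dec (∃[ β ] (β LM.∈ Ω × Good α β))
    dec α with search (λ β → M + C * m * pairs rareᵢ α β ≤? C * pairs one α β) Ω
    ... | inj₁ found = yes found
    ... | inj₂ none  = no λ { (β , β∈ , g) → none β β∈ g }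
  ... | inj₁ (α , α∈ , β , β∈ , g) = α , β , α∈ , β∈ , g
  ... | inj₂ none = ⊥-elim (<-irrefl refl (begin-strict
      M * (W * W) + M * (W * W)      ≡⟨ r₁ M (W * W) ⟩
      2 * (M * (W * W))              ≤⟨ *-monoʳ-≤ 2 many ⟩
      2 * (D * D * Σπ²)              ≡⟨ *-assoc 2 (D * D) Σπ² ⟨
      C * Σπ²                        <⟨ +-monoˡ-≤ (C * Σπ²) (*-mono-≤ W>0 W>0) ⟩
      W * W + C * Σπ²                ≡⟨ cong (λ z → W * W + C * z) all-pairs ⟩
      W * W + C * ∑∑ (pairs one)     ≡⟨ cong₂ _+_ (∑-*-∑ Ω Ω w w) (∑∑-*ˡ C (pairs one)) ⟨
      ∑ Ω (λ α → ∑ Ω (λ β → w α * w β)) + ∑ Ω (λ α → ∑ Ω (λ β → C * (w α * w β * pairs one α β)))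
        ≡⟨ trans (∑-cong Ω (λ α → ∑-+ Ω _ _)) (∑-+ Ω _ _) ⟨
      ∑ Ω (λ α → ∑ Ω (λ β → w α * w β + C * (w α * w β * pairs one α β)))
        ≤⟨ ∑-mono-∈ Ω (λ α α∈ → ∑-mono-∈ Ω (λ β β∈ → point α α∈ β β∈)) ⟩
      ∑ Ω (λ α → ∑ Ω (λ β → M * (w α * w β) + C * m * (w α * w β * pairs rareᵢ α β)))
        ≡⟨ trans (∑-cong Ω (λ α → ∑-+ Ω _ _)) (∑-+ Ω _ _) ⟩
      ∑ Ω (λ α → ∑ Ω (λ β → M * (w α * w β))) + ∑ Ω (λ α → ∑ Ω (λ β → C * m * (w α * w β * pairs rareᵢ α β)))
        ≡⟨ cong₂ _+_ (trans (trans (∑-cong Ω (λ α → ∑-*ˡ Ω M _)) (∑-*ˡ Ω M _)) (cong (M *_) (∑-*-∑ Ω Ω w w)))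
                     (∑∑-*ˡ (C * m) (pairs rareᵢ)) ⟩
      M * (W * W) + C * m * ∑∑ (pairs rareᵢ)   ≡⟨ cong (λ z → M * (W * W) + C * m * z) (second-moment rareᵢ) ⟨
      M * (W * W) + C * m * Σrare              ≤⟨ +-monoʳ-≤ (M * (W * W)) (≤-trans (*-monoˡ-≤ Σrare Q-large) few) ⟩
      M * (W * W) + M * (W * W) ∎))
    where
    open ≤-Reasoning
    ∑∑ : (I → I → ℕ) → ℕ
    ∑∑ f = ∑ Ω (λ α → ∑ Ω (λ β → w α * w β * f α β))
    ∑∑-*ˡ : ∀ c f → ∑ Ω (λ α → ∑ Ω (λ β → c * (w α * w β * f α β))) ≡ c * ∑∑ f
    ∑∑-*ˡ c f = trans (∑-cong Ω (λ α → ∑-*ˡ Ω c _)) (∑-*ˡ Ω c _)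
    r₁ : ∀ M W → M * W + M * W ≡ 2 * (M * W)
    r₁ = solve-∀
    all-pairs : Σπ² ≡ ∑∑ (pairs one)
    all-pairs = trans (∑-cong L (λ a → ∑-cong R (λ b → sym (+-identityʳ _)))) (second-moment one)
    r₂ : ∀ w c p → w + c * (w * p) ≡ w * (1 + c * p)
    r₂ = solve-∀
    r₃ : ∀ w M c p → w * (M + c * p) ≡ M * w + c * (w * p)
    r₃ = solve-∀
    point : ∀ α → α LM.∈ Ω → ∀ β → β LM.∈ Ω →
      w α * w β + C * (w α * w β * pairs one α β) ≤ M * (w α * w β) + C * m * (w α * w β * pairs rareᵢ α β)
    point α α∈ β β∈ = begin
      w α * w β + C * (w α * w β * pairs one α β)  ≡⟨ r₂ (w α * w β) C _ ⟩
      w α * w β * (1 + C * pairs one α β)          ≤⟨ *-monoʳ-≤ (w α * w β) (≰⇒> (λ g → none α α∈ (β , β∈ , g))) ⟩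
      w α * w β * (M + C * m * pairs rareᵢ α β)    ≡⟨ r₃ (w α * w β) M (C * m) _ ⟩
      M * (w α * w β) + C * m * (w α * w β * pairs rareᵢ α β) ∎

  rich-rectangle : Σ I λ α → Σ (X → Bool) λ A → Σ (X → Bool) λ B → (
    (∀ a → A a ≡ true → U α a ≡ true) × (∀ b → B b ≡ true → V α b ≡ true) ×
    m ≤ C * ∑ L (λ a → 𝟙 (A a)) × m ≤ C * ∑ R (λ b → 𝟙 (B b)) × α LM.∈ Ω ×
    (∀ a b → b LM.∈ R → A a ≡ true → B b ≡ true → W ≤ Q * π a b))
  rich-rectangle with good-pair
  ... | α , β , α∈ , β∈ , good = α , A₁ , B₁ ,
      (λ a p → proj₁ (∧-true {U α a} (proj₁ (∧-true {A₀ a} p)))) , (λ b p → proj₁ (∧-true {V α b} p)) ,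
      *-cancelʳ-≤ m _ m {{>-nonZero m>0}} (≤-trans big (≤-trans
        (*-monoʳ-≤ C (*-monoʳ-≤ nA (≤-trans (∑≤length R B₁) R≤))) (≤-reflexive (sym (*-assoc C nA m))))) ,
      *-cancelʳ-≤ m _ m {{>-nonZero m>0}} (≤-trans big (≤-trans
        (*-monoʳ-≤ C (*-monoˡ-≤ nB (≤-trans (∑≤length L A₁) L≤))) (≤-reflexive (r₀ C m nB)))) ,
      α∈ , frequent
    where
    open ≤-Reasoning
    r₀ : ∀ C m b → C * (m * b) ≡ C * b * m
    r₀ = solve-∀
    A₀ B₁ A₁ : X → Bool
    A₀ = U₂ α β
    B₁  = V₂ α β
    -- The deletion: only those elements stay that form no rare pair with an element of `B₁`.
    A₁ a = A₀ a ∧ all (λ b → not (rare a b ∧ B₁ b)) R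
    nA₀ nA nB : ℕ
    nA₀ = ∑ L (λ a → 𝟙 (A₀ a))
    nA = ∑ L (λ a → 𝟙 (A₁ a))
    nB = ∑ R (λ b → 𝟙 (B₁ b))
    frequent : ∀ a b → b LM.∈ R → A₁ a ≡ true → B₁ b ≡ true → W ≤ Q * π a b
    frequent a b b∈ pA pB with all-not (λ b → rare a b ∧ B₁ b) R (proj₂ (∧-true {A₀ a} pA)) b∈
    ... | eq rewrite pB with rare a b in r
    ... | false = <ᵇ-false r
    r₁ : ∀ r b → r * (1 * b) ≡ r * b
    r₁ = solve-∀
    point : ∀ a → 𝟙 (A₀ a) ≤ 𝟙 (A₁ a) + ∑ R (λ b → rareᵢ a b * (𝟙 (A₀ a) * 𝟙 (B₁ b)))
    point a with A₀ a
    ... | false = z≤n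
    ... | true  = ≤-trans (none-or-some (λ b → rare a b ∧ B₁ b) R)
      (+-monoʳ-≤ _ (≤-reflexive (∑-cong R (λ b → trans (𝟙-∧ (rare a b) (B₁ b)) (sym (r₁ (rareᵢ a b) (𝟙 (B₁ b))))))))
    -- Every deleted element is charged to a rare pair containing it.
    thin : nA₀ ≤ nA + pairs rareᵢ α β
    thin = ≤-trans (∑-mono L point) (≤-reflexive (∑-+ L _ _))
    big : m * m ≤ C * (nA * nB)
    big = +-cancelʳ-≤ (C * m * pairs rareᵢ α β) _ _ (begin
      M + C * m * pairs rareᵢ α β    ≤⟨ good ⟩
      C * pairs one α β              ≡⟨ cong (C *_) (trans (∑-cong L (λ a → ∑-cong R (λ b → +-identityʳ _)))
                                          (∑-*-∑ L R _ _)) ⟩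
      C * (nA₀ * nB)                 ≤⟨ *-monoʳ-≤ C (*-monoˡ-≤ nB thin) ⟩
      C * ((nA + pairs rareᵢ α β) * nB)   ≡⟨ r₂ C nA (pairs rareᵢ α β) nB ⟩
      C * (nA * nB) + C * nB * pairs rareᵢ α β
        ≤⟨ +-monoʳ-≤ (C * (nA * nB)) (*-monoˡ-≤ (pairs rareᵢ α β) (*-monoʳ-≤ C (≤-trans (∑≤length R B₁) R≤))) ⟩
      C * (nA * nB) + C * m * pairs rareᵢ α β ∎)
      where
      r₂ : ∀ C a p b → C * ((a + p) * b) ≡ C * (a * b) + C * b * p
      r₂ = solve-∀

-- Ancestors and leaves in rooted trees

iter-suc : ∀ {A : Set} (f : A → A) k x → iter f k (f x) ≡ f (iter f k x)
iter-suc f zero    x = refl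
iter-suc f (suc k) x = cong f (iter-suc f k x)

n<2^n : ∀ n → n < 2 ^ n
n<2^n zero    = s≤s z≤n
n<2^n (suc n) = +-mono-≤-< (m^n>0 2 n) (subst (n <_) (sym (+-identityʳ (2 ^ n))) (n<2^n n))

module _ {n : ℕ} (T : RTree n) where

  -- On the way up from any other vertex the last step would exhibit a child of the root.
  root-leaf-only : IsLeaf T (root T) → ∀ v → v ∈ verts T → v ≡ root T
  root-leaf-only (_ , childless) v v∈ with reaches T v v∈
  ... | k , reach = go k v v∈ reach
    where
    go : ∀ k v → v ∈ verts T → iter (parent T) k v ≡ root T → v ≡ root T
    go zero    v v∈ eq = eq
    go (suc k) v v∈ eq with v ≟ root T
    ... | yes v≡ = v≡
    ... | no  v≢ = ⊥-elim (childless v (v∈ , v≢ ,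
      go k (parent T v) (parent∈ T v v∈ v≢) (trans (iter-suc (parent T) k v) eq)))

  anc-up : ∀ {v w} → w ≢ root T → Anc T (parent T w) v → Anc T w v
  anc-up {w = w} w≢ (k , eq , before) = suc k , trans (sym (iter-suc (parent T) k w)) eq , before'
    where
    before' : ∀ k' → k' < suc k → iter (parent T) k' w ≢ root T
    before' zero     _         = w≢
    before' (suc k') (s≤s k'<) e = before k' k'< (trans (iter-suc (parent T) k' w) e)

  anc-root : ∀ v → v ∈ verts T → Anc T v (root T)
  anc-root v v∈ with reaches T v v∈
  ... | k , reach = go k v reach
    where
    go : ∀ k v → iter (parent T) k v ≡ root T → Anc T v (root T)
    go k v eq with v ≟ root T
    go k       v eq | yes v≡ = 0 , v≡ , λ _ ()
    go zero    v eq | no  v≢ = ⊥-elim (v≢ eq)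
    go (suc k) v eq | no  v≢ = anc-up v≢ (go k (parent T v) (trans (iter-suc (parent T) k v) eq))

  anc-verts : ∀ {ℓ v} → ℓ ∈ verts T → Anc T ℓ v → v ∈ verts T
  anc-verts {ℓ} ℓ∈ (k , refl , before) = go k before
    where
    go : ∀ k → (∀ k' → k' < k → iter (parent T) k' ℓ ≢ root T) → iter (parent T) k ℓ ∈ verts T
    go zero    _      = ℓ∈
    go (suc k) before = parent∈ T _ (go k (λ k' k'< → before k' (m<n⇒m<1+n k'<))) (before k ≤-refl)

  anc-inner : ∀ {ℓ v} → ℓ ∈ verts T → Anc T ℓ v → v ≡ ℓ ⊎ ¬ IsLeaf T v
  anc-inner ℓ∈ (zero , refl , _) = inj₁ refl
  anc-inner {ℓ} ℓ∈ (suc k , refl , before) = inj₂ λ (_ , childless) →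
    childless (iter (parent T) k ℓ)
      (anc-verts ℓ∈ (k , refl , λ k' k'< → before k' (m<n⇒m<1+n k'<)) , before k ≤-refl , refl)

  child? : ∀ u w → Dec (Child T u w)
  child? u w = (w ∈? verts T) ×-dec (¬? (w ≟ root T) ×-dec (parent T w ≟ u))

  isLeaf? : ∀ v → Dec (IsLeaf T v)
  isLeaf? v = (v ∈? verts T) ×-dec map′ (λ ¬∃ w c → ¬∃ (w , c)) (λ ∀¬ (w , c) → ∀¬ w c) (¬? (any? (child? v)))

  -- Descends through children as long as there are any. A vertex `j` steps below `v` does not meet
  -- the root in fewer than `j` steps, so `j` stays below the depth bound `h` and `h` units of fuel
  -- suffice.
  leaf-below : ∀ h → (∀ v → v ∈ verts T → ∃[ k ] (iter (parent T) k v ≡ root T × k < h)) →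
    ∀ v → v ∈ verts T → ∃[ ℓ ] ∃[ k ] (IsLeaf T ℓ × iter (parent T) k ℓ ≡ v × k < h)
  leaf-below h shallow v v∈ = go h 0 v v∈ refl (λ _ ()) (+-identityʳ h)
    where
    below : ∀ j w → w ∈ verts T → (∀ k → k < j → iter (parent T) k w ≢ root T) → j < h
    below j w w∈ before with shallow w w∈
    ... | k , reach , k<h = ≤-<-trans (≮⇒≥ (λ k<j → before k k<j reach)) k<h
    go : ∀ fuel j w → w ∈ verts T → iter (parent T) j w ≡ v →
      (∀ k → k < j → iter (parent T) k w ≢ root T) → fuel + j ≡ h →
      ∃[ ℓ ] ∃[ k ] (IsLeaf T ℓ × iter (parent T) k ℓ ≡ v × k < h)
    go zero j w w∈ _ before refl = ⊥-elim (<-irrefl refl (below j w w∈ before))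
    go (suc fuel) j w w∈ eq before refl with any? (child? w)
    ... | no  none = w , j , (w∈ , λ c ch → none (c , ch)) , eq , below j w w∈ before
    ... | yes (c , c∈ , c≢ , refl) = go fuel (suc j) c c∈
      (trans (sym (iter-suc (parent T) j c)) eq) before' (+-suc fuel j)
      where
      before' : ∀ k → k < suc j → iter (parent T) k c ≢ root T
      before' zero    _        = c≢
      before' (suc k) (s≤s k<) e = before k k< (trans (iter-suc (parent T) k c) e)

-- Counting the vertices of a binary-tree-based graph

rank : ∀ {n} (p : Subset n) v → v ∈ p → Fin ∣ p ∣
rank (true ∷ p)  zero    Vec.here       = zero
rank (true ∷ p)  (suc v) (Vec.there v∈) = suc (rank p v v∈)
rank (false ∷ p) (suc v) (Vec.there v∈) = rank p v v∈

rank-injective : ∀ {n} (p : Subset n) {v w} (v∈ : v ∈ p) (w∈ : w ∈ p) → rank p v v∈ ≡ rank p w w∈ → v ≡ w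
rank-injective (true ∷ p)  Vec.here       Vec.here       eq = refl
rank-injective (true ∷ p)  (Vec.there v∈) (Vec.there w∈) eq = cong suc (rank-injective p v∈ w∈ (suc-injective eq))
rank-injective (false ∷ p) (Vec.there v∈) (Vec.there w∈) eq = cong suc (rank-injective p v∈ w∈ eq)

module Forest {n : ℕ} (H : BTBG n) where

  m : ℕ
  m = nroots H

  private
    ∈-⋃ : ∀ {A : Set} (f : A → Subset n) {x} xs → x LM.∈ xs → f x ⊆ ⋃ (map f xs)
    ∈-⋃ f (x ∷ xs) (here refl) = p⊆p∪q (⋃ (map f xs))
    ∈-⋃ f (x ∷ xs) (there x∈)  = q⊆p∪q (f x) (⋃ (map f xs)) ∘ ∈-⋃ f xs x∈

  root∈Roots : ∀ i → root (tree H i) ∈ Roots H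
  root∈Roots i = ∈-⋃ (λ i → ⁅ root (tree H i) ⁆) (allFin (ntrees H)) (∈-allFin i) (x∈⁅x⁆ _)

  leaf-two : ∀ {v k₁ k₂ k₃} → IsLeaf (tree H k₁) v → IsLeaf (tree H k₂) v → IsLeaf (tree H k₃) v →
    k₁ ≡ k₂ ⊎ k₁ ≡ k₃ ⊎ k₂ ≡ k₃
  leaf-two {v} {k₁} {k₂} {k₃} l₁ l₂ l₃ with leafTwice H k₁ v l₁
  ... | j , _ , _ , only with only k₂ l₂ | only k₃ l₃
  ... | inj₁ refl | _         = inj₁ refl
  ... | inj₂ _    | inj₁ refl = inj₂ (inj₁ refl)
  ... | inj₂ refl | inj₂ refl = inj₂ (inj₂ refl)

  -- A linear bound in place of the logarithmic one is enough to make `n` polynomial in `m`; it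
  -- follows from `m < 2 ^ m`.
  depth-bound : HeightCond H → ∀ i v → v ∈ verts (tree H i) →
    ∃[ k ] (iter (parent (tree H i)) k v ≡ root (tree H i) × k < m + 3)
  depth-bound hc i v v∈ with hc i v v∈
  ... | k , reach , small with k <? m + 3
  ...   | yes k< = k , reach , k<
  ...   | no k≮ = ⊥-elim (<-irrefl refl (begin-strict
    m ^ 10                   ≤⟨ ^-monoˡ-≤ 10 (<⇒≤ (n<2^n m)) ⟩
    (2 ^ m) ^ 10             ≡⟨ ^-*-assoc 2 m 10 ⟩
    2 ^ (m * 10)             ≡⟨ cong (2 ^_) (*-comm m 10) ⟩
    2 ^ (10 * m)             ≤⟨ ^-monoʳ-≤ 2 (*-monoˡ-≤ m (m≤m+n 10 39)) ⟩
    2 ^ (49 * m)             <⟨ ^-monoʳ-< 2 (s≤s (s≤s z≤n)) (*-monoʳ-< 49 t) ⟩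
    2 ^ (49 * (suc k ∸ 3))   ≤⟨ small ⟩
    m ^ 10                   ∎))
    where
    open ≤-Reasoning
    t : m < suc k ∸ 3
    t = subst (_≤ suc k ∸ 3) (m+n∸n≡m (suc m) 3) (∸-monoˡ-≤ 3 (s≤s (≮⇒≥ k≮)))

  -- A vertex is coded by the root of a tree `i` through it, the root of the second tree `j` at a
  -- leaf `ℓ` below it, and the distance from `ℓ` up to it. Since two trees share at most one
  -- vertex, `i` and `j` determine `ℓ`.
  few-vertices : HeightCond H → n ≤ m * (m * (m + 3))
  few-vertices hc = injective⇒≤ {f = code} code-injective
    where
    record Place (v : Fin n) : Set where
      pattern
      constructor at
      field
        i j   : Fin (ntrees H)
        i∌    : v ∈ verts (tree H i)
        j≢i   : j ≢ i
        ℓ     : Fin n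
        k     : ℕ
        leafᵢ : IsLeaf (tree H i) ℓ
        leafⱼ : IsLeaf (tree H j) ℓ
        up    : iter (parent (tree H i)) k ℓ ≡ v
        k<    : k < m + 3
    place : ∀ v → Place v
    place v with covers H v
    ... | i , v∈ with leaf-below (tree H i) (m + 3) (depth-bound hc i) v v∈
    ... | ℓ , k , leaf , up , k< with leafTwice H i ℓ leaf
    ... | j , j≢i , leaf' , _ = at i j v∈ j≢i ℓ k leaf leaf' up k<
    code : Fin n → Fin (m * (m * (m + 3)))
    code v = combine (rank (Roots H) _ (root∈Roots i)) (combine (rank (Roots H) _ (root∈Roots j)) (fromℕ< k<))
      where open Place (place v)
    -- Roots may fail to determine their trees: distinct trees with a common root consist of that
    -- single vertex. The vertices to be compared then both equal this root.
    shared-root : ∀ {i i'} → i ≢ i' → root (tree H i) ≡ root (tree H i') → IsLeaf (tree H i) (root (tree H i)) × IsLeaf (tree H i') (root (tree H i'))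
    shared-root {i} {i'} i≢ eq
      with shareLeaf H i i' i≢ (root (tree H i)) (root∈ (tree H i)) (subst (_∈ verts (tree H i')) (sym eq) (root∈ (tree H i')))
    ... | l , l' = l , subst (IsLeaf (tree H i')) eq l'
    same : ∀ {v v'} (p : Place v) (p' : Place v') → let open Place in
      root (tree H (i p)) ≡ root (tree H (i p')) → root (tree H (j p)) ≡ root (tree H (j p')) → k p ≡ k p' → v ≡ v'
    same (at i j v∈ j≢i ℓ k li lj up _) (at i' j' v'∈ _ ℓ' _ li' lj' up' _) eqᵢ eqⱼ refl with i ≟ i'
    ... | no i≢ with shared-root i≢ eqᵢ
    ...   | l , l' = trans (root-leaf-only (tree H i) l _ v∈) (trans eqᵢ (sym (root-leaf-only (tree H i') l' _ v'∈)))
    same (at i j v∈ j≢i ℓ k li lj up _) (at i j' v'∈ _ ℓ' _ li' lj' up' _) eqᵢ eqⱼ refl | yes refl =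
      trans (sym up) (trans (cong (iter _ k) ℓ≡) up')
      where
      ℓ≡ : ℓ ≡ ℓ'
      ℓ≡ with j ≟ j'
      ... | no j≢ with shared-root j≢ eqⱼ
      ...   | l , l' = trans (root-leaf-only (tree H j) l _ (proj₁ lj)) (trans eqⱼ (sym (root-leaf-only (tree H j') l' _ (proj₁ lj'))))
      ℓ≡ | yes refl = shareOne H i j (λ e → j≢i (sym e)) _ _ (proj₁ li) (proj₁ lj) (proj₁ li') (proj₁ lj')
    code-injective : ∀ {v v'} → code v ≡ code v' → v ≡ v'
    code-injective {v} {v'} eq with combine-injective _ _ _ _ eq
    ... | e₁ , eq' with combine-injective _ _ _ _ eq'
    ... | e₂ , e₃ = same (place v) (place v')
      (rank-injective (Roots H) _ _ e₁) (rank-injective (Roots H) _ _ e₂) (fromℕ<-injective _ _ _ _ e₃)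

  -- Pseudoedges and the assignments attached to a list of them

  record PEdge : Set where
    field
      i j   : Fin (ntrees H)
      i≢j   : i ≢ j
      ℓ     : Fin n
      leafᵢ : IsLeaf (tree H i) ℓ
      leafⱼ : IsLeaf (tree H j) ℓ
    a b : Fin n
    a = root (tree H i)
    b = root (tree H j)
  open PEdge

  End : PEdge → Fin n → Set
  End e v = v ≡ a e ⊎ v ≡ b e

  leaf-through : ∀ e k → ℓ e ∈ verts (tree H k) → k ≡ i e ⊎ k ≡ j e
  leaf-through e k ℓ∈ with k ≟ i e
  ... | yes k≡ = inj₁ k≡
  ... | no k≢ with shareLeaf H k (i e) k≢ (ℓ e) ℓ∈ (proj₁ (leafᵢ e))
  ...   | l , _ with leaf-two l (leafᵢ e) (leafⱼ e)
  ...     | inj₁ k≡        = inj₁ k≡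
  ...     | inj₂ (inj₁ k≡) = inj₂ k≡
  ...     | inj₂ (inj₂ i≡) = ⊥-elim (i≢j e i≡)

  -- Covers the trees with one vertex, whose root is also their leaf.
  root-on-leaf : ∀ e k → root (tree H k) ≡ ℓ e → End e (root (tree H k))
  root-on-leaf e k eq with leaf-through e k (subst (_∈ verts (tree H k)) eq (root∈ (tree H k)))
  ... | inj₁ refl = inj₁ refl
  ... | inj₂ refl = inj₂ refl

  leaf-root : ∀ {v} k k' → IsLeaf (tree H k) v → v ≡ root (tree H k') → IsLeaf (tree H k') v
  leaf-root {v} k k' l eq with k ≟ k'
  ... | yes refl = l
  ... | no  k≢   = proj₂ (shareLeaf H k k' k≢ v (proj₁ l) (subst (_∈ verts (tree H k')) (sym eq) (root∈ (tree H k'))))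

  -- A root that is a leaf is the only vertex of its tree, and this tree contains `ℓ e`.
  leaf-end : ∀ e {v} k → IsLeaf (tree H k) v → End e v → v ≡ ℓ e
  leaf-end e k l (inj₁ eq) = trans eq (sym (root-leaf-only (tree H (i e))
    (subst (IsLeaf (tree H (i e))) eq (leaf-root k (i e) l eq)) (ℓ e) (proj₁ (leafᵢ e))))
  leaf-end e k l (inj₂ eq) = trans eq (sym (root-leaf-only (tree H (j e))
    (subst (IsLeaf (tree H (j e))) eq (leaf-root k (j e) l eq)) (ℓ e) (proj₁ (leafⱼ e))))

  leaf? : ∀ v → Dec (∃[ k ] IsLeaf (tree H k) v)
  leaf? v = any? (λ k → isLeaf? (tree H k) v)

  Distinct : ∀ {k} → Vec PEdge k → Set
  Distinct []      = ⊤
  Distinct (e ∷ K) = a e ≢ b e × (∀ r v → End (lookup K r) v → ¬ End e v) × Distinct K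

  -- The order of the tests matters: in a tree with one vertex the leaf of `e` is itself an end and
  -- has to carry the value of that end.
  assign : ∀ {k} → Vec PEdge k → Vec Bool k → Fin n → Bool
  assign []      []      v = does (leaf? v)
  assign (e ∷ K) (c ∷ x) v with v ≟ a e | v ≟ b e | v ≟ ℓ e
  ... | yes _ | _     | _     = c
  ... | no _  | yes _ | _     = not c
  ... | no _  | no _  | yes _ = false
  ... | no _  | no _  | no _  = assign K x v

  assign-skip : ∀ {k} e (K : Vec PEdge k) c x {v} → ¬ End e v → v ≢ ℓ e → assign (e ∷ K) (c ∷ x) v ≡ assign K x v
  assign-skip e K c x {v} ¬end v≢ with v ≟ a e | v ≟ b e | v ≟ ℓ e
  ... | yes p | _     | _     = ⊥-elim (¬end (inj₁ p))
  ... | no _  | yes p | _     = ⊥-elim (¬end (inj₂ p))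
  ... | no _  | no _  | yes p = ⊥-elim (v≢ p)
  ... | no _  | no _  | no _  = refl

  assign-root : ∀ {k} e (K : Vec PEdge k) c x t → ¬ End e (root (tree H t)) →
    assign (e ∷ K) (c ∷ x) (root (tree H t)) ≡ assign K x (root (tree H t))
  assign-root e K c x t ¬end = assign-skip e K c x ¬end (λ eq → ¬end (root-on-leaf e t eq))

  assign-a : ∀ {k} (K : Vec PEdge k) x → Distinct K → ∀ r → assign K x (a (lookup K r)) ≡ lookup x r
  assign-a (e ∷ K) (c ∷ x) D zero with a e ≟ a e
  ... | yes _ = refl
  ... | no ¬p = ⊥-elim (¬p refl)
  assign-a (e ∷ K) (c ∷ x) (_ , fresh , D) (suc r) =
    trans (assign-root e K c x (i (lookup K r)) (fresh r _ (inj₁ refl))) (assign-a K x D r)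

  assign-b : ∀ {k} (K : Vec PEdge k) x → Distinct K → ∀ r → assign K x (b (lookup K r)) ≡ not (lookup x r)
  assign-b (e ∷ K) (c ∷ x) (a≢b , _) zero with b e ≟ a e | b e ≟ b e
  ... | yes p | _     = ⊥-elim (a≢b (sym p))
  ... | no _  | yes _ = refl
  ... | no _  | no ¬p = ⊥-elim (¬p refl)
  assign-b (e ∷ K) (c ∷ x) (_ , fresh , D) (suc r) =
    trans (assign-root e K c x (j (lookup K r)) (fresh r _ (inj₂ refl))) (assign-b K x D r)

  assign-other-leaf : ∀ {k} (K : Vec PEdge k) x t {v} → IsLeaf (tree H t) v →
    (∀ r → v ≢ ℓ (lookup K r)) → assign K x v ≡ true
  assign-other-leaf []      []      t {v} l _ with leaf? v
  ... | yes _ = refl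
  ... | no ¬l = ⊥-elim (¬l (t , l))
  assign-other-leaf (e ∷ K) (c ∷ x) t l other =
    trans (assign-skip e K c x (λ end → other zero (leaf-end e t l end)) (other zero))
          (assign-other-leaf K x t l (λ r → other (suc r)))

  -- A clause whose leaf does not belong to an edge of `K` is satisfied by that leaf. Otherwise it
  -- is the clause of an edge of `K`, whose ends carry opposite values.
  phi-assign : ∀ {k} (K : Vec PEdge k) x → Distinct K → Phi H (assign K x)
  phi-assign K x D s t v s≢t ls lt with any? (λ r → v ≟ ℓ (lookup K r))
  ... | no other = v , inj₁ (0 , refl , λ _ ()) , assign-other-leaf K x s ls (λ r eq → other (r , eq))
  ... | yes (r , refl) with lookup x r in eq
  ...   | true  = a e , above (leaf-two (leafᵢ e) ls lt) , trans (assign-a K x D r) eq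
    where
    e = lookup K r
    above : i e ≡ s ⊎ i e ≡ t ⊎ s ≡ t → Anc (tree H s) (ℓ e) (a e) ⊎ Anc (tree H t) (ℓ e) (a e)
    above (inj₁ refl)        = inj₁ (anc-root (tree H s) _ (proj₁ ls))
    above (inj₂ (inj₁ refl)) = inj₂ (anc-root (tree H t) _ (proj₁ lt))
    above (inj₂ (inj₂ s≡t))  = ⊥-elim (s≢t s≡t)
  ...   | false = b e , above (leaf-two (leafⱼ e) ls lt) , trans (assign-b K x D r) (cong not eq)
    where
    e = lookup K r
    above : j e ≡ s ⊎ j e ≡ t ⊎ s ≡ t → Anc (tree H s) (ℓ e) (b e) ⊎ Anc (tree H t) (ℓ e) (b e)
    above (inj₁ refl)        = inj₁ (anc-root (tree H s) _ (proj₁ ls))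
    above (inj₂ (inj₁ refl)) = inj₂ (anc-root (tree H t) _ (proj₁ lt))
    above (inj₂ (inj₂ s≡t))  = ⊥-elim (s≢t s≡t)

  assign-own-leaf : ∀ {k} (K : Vec PEdge k) x r → ¬ End (lookup K r) (ℓ (lookup K r)) →
    assign K x (ℓ (lookup K r)) ≡ false
  assign-own-leaf (e ∷ K) (c ∷ x) zero ¬end with ℓ e ≟ a e | ℓ e ≟ b e | ℓ e ≟ ℓ e
  ... | yes p | _     | _     = ⊥-elim (¬end (inj₁ p))
  ... | no _  | yes p | _     = ⊥-elim (¬end (inj₂ p))
  ... | no _  | no _  | yes _ = refl
  ... | no _  | no _  | no ¬p = ⊥-elim (¬p refl)
  assign-own-leaf (e ∷ K) (c ∷ x) (suc r) ¬end with ℓ (lookup K r) ≟ a e | ℓ (lookup K r) ≟ b e | ℓ (lookup K r) ≟ ℓ e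
  -- The leaf of one edge coincides with an end of another only if it is a root, and a root on the
  -- leaf of an edge is an end of that edge.
  ... | yes p | _     | _     = ⊥-elim (¬end (subst (End (lookup K r)) (sym p) (root-on-leaf (lookup K r) (i e) (sym p))))
  ... | no _  | yes p | _     = ⊥-elim (¬end (subst (End (lookup K r)) (sym p) (root-on-leaf (lookup K r) (j e) (sym p))))
  ... | no _  | no _  | yes _ = refl
  ... | no _  | no _  | no _  = assign-own-leaf K x r ¬end

  inner-elsewhere : ∀ {s v} t → v ∈ verts (tree H s) → ¬ IsLeaf (tree H s) v → v ∈ verts (tree H t) → t ≡ s
  inner-elsewhere {s} {v} t v∈ ¬l v∈t with t ≟ s
  ... | yes eq = eq
  ... | no ne  = ⊥-elim (¬l (proj₂ (shareLeaf H t s ne v v∈t v∈)))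

  assign-inner : ∀ {k} (K : Vec PEdge k) x s {v} → v ∈ verts (tree H s) → ¬ IsLeaf (tree H s) v →
    v ≢ root (tree H s) → assign K x v ≡ false
  assign-inner [] [] s {v} v∈ ¬l v≢ with leaf? v
  ... | no _ = refl
  ... | yes (t , l) with inner-elsewhere t v∈ ¬l (proj₁ l)
  ...   | refl = ⊥-elim (¬l l)
  assign-inner (e ∷ K) (c ∷ x) s {v} v∈ ¬l v≢ with v ≟ a e | v ≟ b e | v ≟ ℓ e
  ... | no _ | no _ | yes _ = refl
  ... | no _ | no _ | no _  = assign-inner K x s v∈ ¬l v≢
  ... | yes refl | _ | _ with inner-elsewhere (i e) v∈ ¬l (root∈ (tree H (i e)))
  ...   | refl = ⊥-elim (v≢ refl)
  assign-inner (e ∷ K) (c ∷ x) s {v} v∈ ¬l v≢ | no _ | yes refl | _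
    with inner-elsewhere (j e) v∈ ¬l (root∈ (tree H (j e)))
  ... | refl = ⊥-elim (v≢ refl)

  assign-on-path : ∀ {k} (K : Vec PEdge k) x r {v} →
    Anc (tree H (i (lookup K r))) (ℓ (lookup K r)) v ⊎ Anc (tree H (j (lookup K r))) (ℓ (lookup K r)) v →
    ¬ End (lookup K r) v → assign K x v ≡ false
  assign-on-path K x r (inj₁ anc) ¬end with anc-inner (tree H (i (lookup K r))) (proj₁ (leafᵢ (lookup K r))) anc
  ... | inj₁ refl = assign-own-leaf K x r ¬end
  ... | inj₂ ¬l   = assign-inner K x _ (anc-verts (tree H (i (lookup K r))) (proj₁ (leafᵢ (lookup K r))) anc) ¬l (¬end ∘ inj₁)
  assign-on-path K x r (inj₂ anc) ¬end with anc-inner (tree H (j (lookup K r))) (proj₁ (leafⱼ (lookup K r))) anc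
  ... | inj₁ refl = assign-own-leaf K x r ¬end
  ... | inj₂ ¬l   = assign-inner K x _ (anc-verts (tree H (j (lookup K r))) (proj₁ (leafⱼ (lookup K r))) anc) ¬l (¬end ∘ inj₂)

  -- Apart from the two ends, every vertex on the path of the `r`-th edge is 0 under both
  -- assignments, hence under any mixture `y` of them.
  clause-falsified : ∀ {k} (K : Vec PEdge k) x x' r (y : Fin n → Bool) →
    (∀ v → y v ≡ assign K x v ⊎ y v ≡ assign K x' v) →
    y (a (lookup K r)) ≡ false → y (b (lookup K r)) ≡ false → ¬ Phi H y
  clause-falsified K x x' r y mixed ya yb φ =
    let v , anc , yv = φ (i e) (j e) (ℓ e) (i≢j e) (leafᵢ e) (leafⱼ e)
    in true≢false (trans (sym yv) (unsat v anc))
    where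
    e = lookup K r
    true≢false : true ≢ false
    true≢false ()
    unsat : ∀ v → Anc (tree H (i e)) (ℓ e) v ⊎ Anc (tree H (j e)) (ℓ e) v → y v ≡ false
    unsat v anc with v ≟ a e | v ≟ b e
    ... | yes refl | _        = ya
    ... | no _     | yes refl = yb
    ... | no v≢a   | no v≢b   = off (mixed v)
      where
      ¬end : ¬ End e v
      ¬end (inj₁ p) = v≢a p
      ¬end (inj₂ p) = v≢b p
      off : y v ≡ assign K x v ⊎ y v ≡ assign K x' v → y v ≡ false
      off (inj₁ eq) = trans eq (assign-on-path K x r anc ¬end)
      off (inj₂ eq) = trans eq (assign-on-path K x' r anc ¬end)

  hits : ∀ {k} → (Fin n → Bool) → (Fin n → Bool) → Vec PEdge k → Vec Bool k
  hits U V = Vec.map (λ e → U (a e) ∧ V (b e))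

  -- The assignments can differ only at ends of edges that are hit, and these ends lie in `U` or
  -- `V`.
  assign-agree : ∀ {k} (K : Vec PEdge k) U V x x' → AgreeOff (hits U V K) x x' →
    ∀ v → U v ≡ false → V v ≡ false → assign K x v ≡ assign K x' v
  assign-agree []      U V []      []        ag        v u f = refl
  assign-agree (e ∷ K) U V (c ∷ x) (c' ∷ x') (ag , ags) v u f with v ≟ a e | v ≟ b e | v ≟ ℓ e
  ... | yes refl | _     | _     = ag (cong (_∧ V (b e)) u)
  ... | no _  | yes refl | _     = cong not (ag (trans (cong (U (a e) ∧_) f) (∧-zeroʳ (U (a e)))))
  ... | no _  | no _  | yes _ = refl
  ... | no _  | no _  | no _  = assign-agree K U V x x' ags v u f

-- Routes in a branching program

is : ∀ {n} → Maybe (Fin n) → Fin n → Bool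
is nothing  v = false
is (just x) v = does (x ≟ v)

is-true : ∀ {n} (x : Maybe (Fin n)) v → is x v ≡ true → x ≡ just v
is-true (just x) v eq with x ≟ v
... | yes refl = refl

is-just : ∀ {n} (v : Fin n) → is (just v) v ≡ true
is-just v with v ≟ v
... | yes _ = refl
... | no ¬p = ⊥-elim (¬p refl)

is-unique : ∀ {n} (x : Maybe (Fin n)) {xs} → Unique xs → ∑ xs (λ v → 𝟙 (is x v)) ≤ 1
is-unique x {[]}     []        = z≤n
is-unique x {v ∷ xs} (v∉ ∷ un) with is x v in eq
... | false = is-unique x un
... | true with is-true x v eq
...   | refl = s≤s (≤-reflexive (trans (zeros v∉) (∑-0 xs)))
  where
  zeros : ∀ {ys} → All (λ y → v ≢ y) ys → ∑ ys (λ y → 𝟙 (does (v ≟ y))) ≡ ∑ ys (λ _ → 0)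
  zeros []       = refl
  zeros {y ∷ _} (ne ∷ nes) with v ≟ y
  ... | yes eq = ⊥-elim (ne eq)
  ... | no _   = zeros nes

∨-true : ∀ a {b} → a ∨ b ≡ true → a ≡ true ⊎ b ≡ true
∨-true true  _  = inj₁ refl
∨-true false eq = inj₂ eq

module Program {n : ℕ} (Z : NBP n) where

  Route : Fin (size Z) → Fin (size Z) → Set
  Route = Path (src Z) (tgt Z)

  labels : ∀ {p q} → Route p q → List (Lit n)
  labels = labelsOf (label Z)

  infixr 5 _++ₚ_
  _++ₚ_ : ∀ {p q r} → Route p q → Route q r → Route p r
  nil      ++ₚ Q = Q
  cons e P ++ₚ Q = cons e (P ++ₚ Q)

  labels-++ : ∀ {p q r} (P : Route p q) (Q : Route q r) → labels (P ++ₚ Q) ≡ labels P ++ labels Q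
  labels-++ nil        Q = refl
  labels-++ (cons e P) Q with label Z e
  ... | just l  = cong (l ∷_) (labels-++ P Q)
  ... | nothing = labels-++ P Q

  count : Fin n → List (Lit n) → ℕ
  count v ls = length (filter (λ l → proj₁ l ≟ v) ls)

  count-++ₚ : ∀ {p q r} v (P : Route p q) (Q : Route q r) →
    count v (labels (P ++ₚ Q)) ≡ count v (labels P) + count v (labels Q)
  count-++ₚ v P Q = trans (cong (count v) (labels-++ P Q))
    (trans (cong length (filter-++ (λ l → proj₁ l ≟ v) (labels P) (labels Q))) (length-++ (filter (λ l → proj₁ l ≟ v) (labels P))))

  Reads : ∀ {p q} → Route p q → Fin n → Set
  Reads P v = 0 < count v (labels P)

  Sat : ∀ {p q} → (Fin n → Bool) → Route p q → Set
  Sat S P = All (λ l → S (proj₁ l) ≡ proj₂ l) (labels P)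

  sat-++ : ∀ {p q r} S (P : Route p q) (Q : Route q r) → Sat S P → Sat S Q → Sat S (P ++ₚ Q)
  sat-++ S P Q sP sQ = subst (All _) (sym (labels-++ P Q)) (++⁺ sP sQ)

  sat-transfer : ∀ {p q} {S y : Fin n → Bool} (P : Route p q) → Sat S P → (∀ v → Reads P v → y v ≡ S v) → Sat y P
  sat-transfer P sat agree = All.tabulate λ {l} l∈ →
    trans (agree (proj₁ l) (∈-length (∈-filter⁺ (λ l' → proj₁ l' ≟ proj₁ l) l∈ refl))) (All.lookup sat l∈)

  loop-silent : ∀ {p q} (P : Route p q) → p ≡ q → ∀ v → ¬ Reads P v
  loop-silent nil        _  v ()
  loop-silent (cons e P) eq = ⊥-elim (acyclic Z e (subst (Route (tgt Z e)) (sym eq) P))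

  edge : ∀ e → Route (src Z e) (tgt Z e)
  edge e = cons e nil

  variable-of : Fin (nedges Z) → Maybe (Fin n)
  variable-of e = Maybe.map proj₁ (label Z e)

  edge-reads : ∀ e v → Reads (edge e) v → variable-of e ≡ just v
  edge-reads e v r with label Z e
  ... | just (x , _) with x ≟ v
  ...   | yes refl = refl

  reads-edge : ∀ e v → variable-of e ≡ just v → Reads (edge e) v
  reads-edge e v eq with label Z e
  reads-edge e v refl | just (x , _) with x ≟ x
  ... | yes _ = s≤s z≤n
  ... | no ¬p = ⊥-elim (¬p refl)

  -- The first and last vertex of a segment of a path, and the variable read on the step to the next
  -- segment, with `nothing` if that step reads none.
  Block : Set
  Block = Fin (size Z) × Fin (size Z) × Maybe (Fin n)

  head : List Block → Fin (size Z)
  head []             = sink Z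
  head ((p , _) ∷ bs) = p

  -- Formulated for routes rather than edges so that the last segment, which ends in the sink, can
  -- be followed by the empty route.
  Step : (Fin n → Bool) → Fin (size Z) → Fin (size Z) → Maybe (Fin n) → Set
  Step S q p' x = Σ (Route q p') λ P →
    Sat S P × (∀ v → Reads P v → x ≡ just v) × (∀ v → x ≡ just v → Reads P v)

  Traced : (Fin n → Bool) → List Block → Set
  Traced S []                 = ⊤
  Traced S ((p , q , x) ∷ bs) = (Σ (Route p q) (Sat S)) × Step S q (head bs) x × Traced S bs

  -- Splicing paths with a common trace

  module Occurrences (occ : Fin (size Z) → Fin (size Z) → Fin n → Bool)
    (occ-sound : ∀ p q v → occ p q v ≡ true → Σ (Route p q) λ P → Reads P v)
    (occ-complete : ∀ {p q} v (P : Route p q) → Reads P v → occ p q v ≡ true) where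

    -- All routes between the two end points count, not only the one taken; so this depends on the
    -- trace alone.
    reads : Block → Fin n → Bool
    reads (p , q , x) v = occ p q v ∨ is x v

    open Colouring reads public

    reads-route : ∀ p q x {v} (P : Route p q) → Reads P v → reads (p , q , x) v ≡ true
    reads-route p q x {v} P r rewrite occ-complete v P r = refl

    reads-step : ∀ p q x {v} → x ≡ just v → reads (p , q , x) v ≡ true
    reads-step p q _ {v} refl rewrite is-just v with occ p q v
    ... | true  = refl
    ... | false = refl

    -- Blocks of colour `true` are taken from the path of `S`, the others from that of `S'`. A
    -- variable read in a block is not avoided by its colour, so there `y` agrees with the
    -- assignment the block is taken from.
    mix : ∀ {S S' y} tr → Traced S (map proj₁ tr) → Traced S' (map proj₁ tr) →
      (∀ v → avoids true tr v ≡ false → y v ≡ S v) → (∀ v → avoids false tr v ≡ false → y v ≡ S' v) →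
      Σ (Route (head (map proj₁ tr)) (sink Z)) (Sat y)
    mix [] _ _ h₁ h₀ = nil , []
    mix {S} {S'} {y} (((p , q , x) , true) ∷ tr) ((P , sP) , (E , sE , cE , _) , T) (_ , _ , T') h₁ h₀ =
      let Q , sQ = mix tr T T' (λ v av → h₁ v (weaken v av)) h₀
      in P ++ₚ E ++ₚ Q , sat-++ y P _ (sat-transfer P sP (λ v r → h₁ v (stop v (reads-route p q x P r))))
           (sat-++ y E Q (sat-transfer E sE (λ v r → h₁ v (stop v (reads-step p q x (cE v r))))) sQ)
      where
      stop : ∀ v → reads (p , q , x) v ≡ true → avoids true (((p , q , x) , true) ∷ tr) v ≡ false
      stop v eq rewrite eq = refl
      weaken : ∀ v → avoids true tr v ≡ false → avoids true (((p , q , x) , true) ∷ tr) v ≡ false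
      weaken v eq rewrite eq with reads (p , q , x) v
      ... | true  = refl
      ... | false = refl
    mix {S} {S'} {y} (((p , q , x) , false) ∷ tr) (_ , _ , T) ((P , sP) , (E , sE , cE , _) , T') h₁ h₀ =
      let Q , sQ = mix tr T T' h₁ (λ v av → h₀ v (weaken v av))
      in P ++ₚ E ++ₚ Q , sat-++ y P _ (sat-transfer P sP (λ v r → h₀ v (stop v (reads-route p q x P r))))
           (sat-++ y E Q (sat-transfer E sE (λ v r → h₀ v (stop v (reads-step p q x (cE v r))))) sQ)
      where
      stop : ∀ v → reads (p , q , x) v ≡ true → avoids false (((p , q , x) , false) ∷ tr) v ≡ false
      stop v eq rewrite eq = refl
      weaken : ∀ v → avoids false tr v ≡ false → avoids false (((p , q , x) , false) ∷ tr) v ≡ false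
      weaken v eq rewrite eq with reads (p , q , x) v
      ... | true  = refl
      ... | false = refl

    -- Here the path is divided into pieces from the start of one block to the start of the next, so
    -- that the steps are included.
    chain : List Block → Fin n → ℕ
    chain []             v = 0
    chain ((p , _) ∷ bs) v = 𝟙 (occ p (head bs) v) + chain bs v

    -- Every piece on which `v` can be read is replaced by a route that does read it. The
    -- concatenation is a single route of the program, to which the bound `d` on repeated reads will
    -- apply.
    chain-route : ∀ {S} bs → Traced S bs → ∀ v →
      Σ (Route (head bs) (sink Z)) λ P → chain bs v ≤ count v (labels P)
    chain-route [] _ v = nil , z≤n
    chain-route ((p , q , x) ∷ bs) ((P , _) , (E , _) , T) v with chain-route bs T v | occ p (head bs) v in eq
    ... | Q , le | false = P ++ₚ E ++ₚ Q ,
      ≤-trans le (≤-trans (m≤n+m _ _) (≤-trans (≤-reflexive (sym (count-++ₚ v E Q)))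
        (≤-trans (m≤n+m _ _) (≤-reflexive (sym (count-++ₚ v P (E ++ₚ Q)))))))
    ... | Q , le | true with occ-sound p (head bs) v eq
    ...   | W , r = W ++ₚ Q , ≤-trans (+-mono-≤ r le) (≤-reflexive (sym (count-++ₚ v W Q)))

    occs≤chain : ∀ {S} bs → Traced S bs → ∀ v → occs bs v ≤ chain bs v
    occs≤chain [] _ v = z≤n
    occs≤chain ((p , q , x) ∷ bs) ((P , _) , (E , _ , _ , cE) , T) v = +-mono-≤ here≤ (occs≤chain bs T v)
      where
      here≤ : 𝟙 (reads (p , q , x) v) ≤ 𝟙 (occ p (head bs) v)
      here≤ with reads (p , q , x) v in eq
      ... | false = z≤n
      ... | true with ∨-true (occ p q v) eq
      ...   | inj₁ o with occ-sound p q v o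
      ...     | W , r rewrite occ-complete v (W ++ₚ E)
                  (≤-trans r (≤-trans (m≤m+n _ _) (≤-reflexive (sym (count-++ₚ v W E))))) = ≤-refl
      here≤ | true | inj₂ o rewrite occ-complete v (P ++ₚ E)
        (≤-trans (cE v (is-true x v o)) (≤-trans (m≤n+m _ _) (≤-reflexive (sym (count-++ₚ v P E))))) = ≤-refl

    -- Cutting a path into blocks

    module Segments (rs : List (Fin n)) (t : ℕ) (t>0 : 0 < t) where

      weight : Fin (size Z) → Fin (size Z) → ℕ
      weight p q = ∑ rs (λ v → 𝟙 (occ p q v))

      Full : List Block → Set
      Full []                       = ⊤
      Full (b ∷ [])                 = ⊤
      Full ((p , _) ∷ bs@(_ ∷ _)) = t ≤ weight p (head bs) × Full bs

      Small : List Block → Set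
      Small bs = ∀ p q x → (p , q , x) LM.∈ bs → weight p q < t

      -- Double counting: every block but the last contributes at least `t` to the sum of `chain`
      -- over `rs`.
      full-length : ∀ bs → Full bs → length bs * t ≤ t + ∑ rs (chain bs)
      full-length []       _ = z≤n
      full-length (b ∷ []) _ = ≤-trans (≤-reflexive (+-identityʳ t)) (m≤m+n t _)
      full-length ((p , _) ∷ bs@(_ ∷ _)) (big , full) = +-monoʳ-≤ t (≤-trans (full-length bs full)
        (≤-trans (+-monoˡ-≤ (∑ rs (chain bs)) big) (≤-reflexive (sym (∑-+ rs _ _)))))

      loop-weight : ∀ p → weight p p < t
      loop-weight p = ≤-<-trans (≤-reflexive (trans (∑-cong rs zero-at) (∑-0 rs))) t>0
        where
        zero-at : ∀ v → 𝟙 (occ p p v) ≡ 0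
        zero-at v with occ p p v in eq
        ... | false = refl
        ... | true with occ-sound p p v eq
        ...   | P , r = ⊥-elim (loop-silent P refl v r)

      record Segmented (S : Fin n → Bool) (p : Fin (size Z)) : Set where
        constructor segmented
        field
          q      : Fin (size Z)
          x      : Maybe (Fin n)
          bs     : List Block
          traced : Traced S ((p , q , x) ∷ bs)
          full   : Full ((p , q , x) ∷ bs)
          small  : Small ((p , q , x) ∷ bs)

      -- Greedy cutting: the current segment `P` grows until the next edge would raise the weight
      -- from its start to `t`. That edge becomes the step, and a new segment begins behind it with
      -- the empty route, whose weight is 0 by acyclicity.
      segment : ∀ S {p c} (P : Route p c) → Sat S P → weight p c < t →
        (Q : Route c (sink Z)) → Sat S Q → Segmented S p
      segment S {p} {c} P sP small nil _ = segmented c nothing []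
        ((P , sP) , (nil , [] , (λ _ ()) , (λ _ ())) , tt) tt λ { _ _ _ (here refl) → small }
      segment S {p} P sP small (cons e Q) sQ with ++⁻ (labels (edge e)) (subst (All _) (labels-++ (edge e) Q) sQ)
      ... | sE , sQ' with weight p (tgt Z e) <? t
      ...   | yes small' = segment S (P ++ₚ edge e) (sat-++ S P (edge e) sP sE) small' Q sQ'
      ...   | no big with segment S {tgt Z e} nil [] (loop-weight (tgt Z e)) Q sQ'
      ...     | segmented q x bs traced full small'' =
        segmented (src Z e) (variable-of e) ((tgt Z e , q , x) ∷ bs)
          ((P , sP) , (edge e , sE , edge-reads e , reads-edge e) , traced)
          (≮⇒≥ big , full)
          λ { _ _ _ (here refl) → small ; p' q' x' (there b∈) → small'' p' q' x' b∈ }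

    Trace : Set
    Trace = List (Block × Bool)

    -- The trace of a path has a large rectangle

    module Rectangle (d : ℕ) (dnbp : IsDNBP Z d) (L R : List (Fin n)) (L-unique : Unique L)
      (m t : ℕ) (t>0 : 0 < t) (sizes : length L + length R ≡ m) (balanced : m * m ≤ 9 * (length L * length R))
      (t-small : 18 * suc d * t ≤ m) (t-large : m ≤ 36 * suc d * t)
      (r₀ D₀ : ℕ) (r₀-large : 36 * suc d * suc d ≤ r₀) (D₀-large : 18 * 2 ^ (d + d) ≤ D₀) where

      open Segments (L ++ R) t t>0

      area : Trace → ℕ
      area tr = ∑ L (λ u → 𝟙 (avoids false tr u)) * ∑ R (λ v → 𝟙 (avoids true tr v))

      -- At most `t * (m * d)` pairs of `L × R` are read by a common block, counted with
      -- multiplicity; this is a small part of `L × R` by the choice of `t`. As no element of `L` or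
      -- `R` is read in more than `d` blocks, a colouring saves at least one in `2 ^ (d + d)` of the
      -- other pairs.
      trace : ∀ S (P : SSPath Z) → Sat S P → ∃[ tr ] (
        Traced S (map proj₁ tr) × head (map proj₁ tr) ≡ source Z ×
        length tr ≤ r₀ × m * m ≤ D₀ * area tr)
      trace S P sP with segment S nil [] (loop-weight (source Z)) P sP
      ... | segmented q x bs' traced full small = result
        where
        bs : List Block
        bs = (source Z , q , x) ∷ bs'

        chain≤d : ∀ v → chain bs v ≤ d
        chain≤d v with chain-route bs traced v
        ... | Q , le = ≤-trans le (dnbp Q v)

        occs≤d : ∀ v → occs bs v ≤ d
        occs≤d v = ≤-trans (occs≤chain bs traced v) (chain≤d v)

        R≤m : length R ≤ m
        R≤m = ≤-trans (m≤n+m _ (length L)) (≤-reflexive sizes)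

        few-blocks : length bs ≤ 36 * suc d * suc d
        few-blocks = *-cancelʳ-≤ (length bs) (36 * suc d * suc d) t {{>-nonZero t>0}} (begin
          length bs * t                          ≤⟨ full-length bs full ⟩
          t + ∑ (L ++ R) (chain bs)              ≤⟨ +-monoʳ-≤ t (∑-mono (L ++ R) chain≤d) ⟩
          t + ∑ (L ++ R) (λ _ → d)               ≡⟨ cong (t +_) (trans (∑-const (L ++ R) d)
                                                      (cong (_* d) (trans (length-++ L) sizes))) ⟩
          t + m * d                              ≤⟨ +-monoʳ-≤ t (*-monoˡ-≤ d t-large) ⟩
          t + 36 * suc d * t * d                 ≤⟨ m≤m+n _ (t * (35 + 36 * d)) ⟩
          t + 36 * suc d * t * d + t * (35 + 36 * d)   ≡⟨ ring d t ⟩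
          36 * suc d * suc d * t                 ∎)
          where
          open ≤-Reasoning
          ring : ∀ d t → t + 36 * (1 + d) * t * d + t * (35 + 36 * d) ≡ 36 * (1 + d) * (1 + d) * t
          ring = solve-∀

        -- The routes between the end points account for fewer than `t` elements and the step for at
        -- most one more.
        block-weight : ∀ b → b LM.∈ bs → ∑ L (λ u → 𝟙 (reads b u)) ≤ t
        block-weight (p' , q' , x') b∈ = begin
          ∑ L (λ u → 𝟙 (reads (p' , q' , x') u))    ≤⟨ ∑-mono L (λ u → 𝟙-∨ (occ p' q' u) (is x' u)) ⟩
          ∑ L (λ u → 𝟙 (occ p' q' u) + 𝟙 (is x' u)) ≡⟨ ∑-+ L _ _ ⟩
          ∑ L (λ u → 𝟙 (occ p' q' u)) + ∑ L (λ u → 𝟙 (is x' u))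
            ≤⟨ +-mono-≤ (≤-trans (m≤m+n _ _) (≤-reflexive (sym (∑-++ L R _)))) (is-unique x' L-unique) ⟩
          weight p' q' + 1                          ≡⟨ +-comm _ 1 ⟩
          suc (weight p' q')                        ≤⟨ small p' q' x' b∈ ⟩
          t ∎
          where
          open ≤-Reasoning
          𝟙-∨ : ∀ a b → 𝟙 (a ∨ b) ≤ 𝟙 a + 𝟙 b
          𝟙-∨ true  b = s≤s z≤n
          𝟙-∨ false b = ≤-refl

        both : Fin n → Fin n → Block → Bool
        both u v b = reads b u ∧ reads b v

        w : Fin n → Fin n → ℕ
        w u v = 𝟙 (all (λ b → not (both u v b)) bs)

        w-zero : ∀ b → b LM.∈ bs → ∀ u v → reads b u ≡ true → reads b v ≡ true → w u v ≡ 0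
        w-zero b b∈ u v p q with all (λ b → not (both u v b)) bs in eq
        ... | false = refl
        ... | true with all-not (both u v) bs eq b∈
        ...   | eq' rewrite p | q with eq'
        ...     | ()

        shared : ℕ
        shared = ∑ L (λ u → ∑ R (λ v → ∑ bs (λ b → 𝟙 (both u v b))))

        few-shared : shared ≤ t * (m * d)
        few-shared = begin
          shared   ≡⟨ ∑-cong L (λ u → ∑-cong R (λ v → ∑-cong bs (λ b → 𝟙-∧ (reads b u) (reads b v)))) ⟩
          ∑ L (λ u → ∑ R (λ v → ∑ bs (λ b → 𝟙 (reads b u) * 𝟙 (reads b v))))  ≡⟨ ∑-rotate L R bs _ ⟩
          ∑ bs (λ b → ∑ L (λ u → ∑ R (λ v → 𝟙 (reads b u) * 𝟙 (reads b v))))  ≡⟨ ∑-cong bs (λ b → ∑-*-∑ L R _ _) ⟩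
          ∑ bs (λ b → ∑ L (λ u → 𝟙 (reads b u)) * ∑ R (λ v → 𝟙 (reads b v)))
            ≤⟨ ∑-mono-∈ bs (λ b b∈ → *-monoˡ-≤ _ (block-weight b b∈)) ⟩
          ∑ bs (λ b → t * ∑ R (λ v → 𝟙 (reads b v)))   ≡⟨ ∑-*ˡ bs t _ ⟩
          t * ∑ bs (λ b → ∑ R (λ v → 𝟙 (reads b v)))   ≡⟨ cong (t *_) (∑-swap bs R _) ⟩
          t * ∑ R (occs bs)                            ≤⟨ *-monoʳ-≤ t (∑-mono R occs≤d) ⟩
          t * ∑ R (λ _ → d)                            ≡⟨ cong (t *_) (∑-const R d) ⟩
          t * (length R * d)                           ≤⟨ *-monoʳ-≤ t (*-monoˡ-≤ d R≤m) ⟩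
          t * (m * d) ∎
          where open ≤-Reasoning

        many-unshared : length L * length R ≤ ∑ L (λ u → ∑ R (w u)) + shared
        many-unshared = begin
          length L * length R                    ≡⟨ cong₂ _*_ (∑-1 L) (∑-1 R) ⟨
          ∑ L (λ _ → 1) * ∑ R (λ _ → 1)          ≡⟨ ∑-*-∑ L R _ _ ⟨
          ∑ L (λ _ → ∑ R (λ _ → 1))              ≤⟨ ∑-mono L (λ u → ∑-mono R (λ v → none-or-some (both u v) bs)) ⟩
          ∑ L (λ u → ∑ R (λ v → w u v + ∑ bs (λ b → 𝟙 (both u v b))))
            ≡⟨ trans (∑-cong L (λ u → ∑-+ R _ _)) (∑-+ L _ _) ⟩
          ∑ L (λ u → ∑ R (w u)) + shared ∎
          where open ≤-Reasoning

        total-bound : ∀ tr → ∑ L (λ u → ∑ R (total tr bs w u)) ≤ 2 ^ (d + d) * area tr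
        total-bound tr = begin
          ∑ L (λ u → ∑ R (total tr bs w u))
            ≤⟨ ∑-mono L (λ u → ∑-mono R (λ v → *-monoʳ-≤ (𝟙 (avoids false tr u) * 𝟙 (avoids true tr v))
                 (*-mono-≤ (𝟙≤1 (all (λ b → not (both u v b)) bs))
                   (^-monoʳ-≤ 2 (+-mono-≤ (occs≤d u) (occs≤d v)))))) ⟩
          ∑ L (λ u → ∑ R (λ v → 𝟙 (avoids false tr u) * 𝟙 (avoids true tr v) * (1 * 2 ^ (d + d))))
            ≡⟨ trans (∑-cong L (λ u → ∑-*ʳ R (1 * 2 ^ (d + d)) _)) (∑-*ʳ L (1 * 2 ^ (d + d)) _) ⟩
          ∑ L (λ u → ∑ R (λ v → 𝟙 (avoids false tr u) * 𝟙 (avoids true tr v))) * (1 * 2 ^ (d + d))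
            ≡⟨ cong (_* (1 * 2 ^ (d + d))) (∑-*-∑ L R _ _) ⟩
          area tr * (1 * 2 ^ (d + d))   ≡⟨ ring (area tr) (2 ^ (d + d)) ⟩
          2 ^ (d + d) * area tr ∎
          where
          open ≤-Reasoning
          ring : ∀ a p → a * (1 * p) ≡ p * a
          ring = solve-∀

        result : ∃[ tr ] (Traced S (map proj₁ tr) × head (map proj₁ tr) ≡ source Z ×
          length tr ≤ r₀ × m * m ≤ D₀ * area tr)
        result with colouring L R bs w w-zero
        ... | tr , eq , bound = tr , subst (Traced S) (sym eq) traced , cong head eq ,
          ≤-trans (≤-reflexive (trans (sym (length-map proj₁ tr)) (cong length eq))) (≤-trans few-blocks r₀-large) ,
          -- A second copy of `m * m` is added on both sides; on the right it absorbs the pairs with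
          -- a common block.
          ≤-trans (+-cancelʳ-≤ (m * m) _ _ (begin
            m * m + m * m                          ≤⟨ +-mono-≤ balanced balanced ⟩
            9 * (length L * length R) + 9 * (length L * length R)   ≡⟨ r₁ (length L * length R) ⟩
            18 * (length L * length R)             ≤⟨ *-monoʳ-≤ 18 (≤-trans many-unshared
                                                       (+-mono-≤ (≤-trans bound (total-bound tr)) few-shared)) ⟩
            18 * (2 ^ (d + d) * area tr + t * (m * d))   ≤⟨ ≤-trans (m≤m+n _ (18 * t * m)) (≤-reflexive (r₂ (2 ^ (d + d)) (area tr) t m d)) ⟩
            18 * 2 ^ (d + d) * area tr + 18 * suc d * t * m   ≤⟨ +-monoʳ-≤ _ (*-monoˡ-≤ m t-small) ⟩
            18 * 2 ^ (d + d) * area tr + m * m ∎)) (*-monoˡ-≤ (area tr) D₀-large)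
          where
          open ≤-Reasoning
          r₁ : ∀ x → 9 * x + 9 * x ≡ 18 * x
          r₁ = solve-∀
          r₂ : ∀ p a t m d → 18 * (p * a + t * (m * d)) + 18 * t * m ≡ 18 * p * a + 18 * (1 + d) * t * m
          r₂ = solve-∀

-- Counting lists, subsets of given size, and auxiliary inequalities

length-cartesianProductWith : ∀ {A B C : Set} (f : A → B → C) xs ys →
  length (cartesianProductWith f xs ys) ≡ length xs * length ys
length-cartesianProductWith f []       ys = refl
length-cartesianProductWith f (x ∷ xs) ys =
  trans (length-++ (map (f x) ys)) (cong₂ _+_ (length-map (f x) ys) (length-cartesianProductWith f xs ys))

listsUpTo : ∀ {A : Set} → ℕ → List A → List (List A)
listsUpTo zero    xs = [] ∷ []
listsUpTo (suc r) xs = [] ∷ cartesianProductWith _∷_ xs (listsUpTo r xs)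

∈-listsUpTo : ∀ {A : Set} {xs : List A} → (∀ x → x LM.∈ xs) → ∀ r ys → length ys ≤ r → ys LM.∈ listsUpTo r xs
∈-listsUpTo full zero    []       _       = here refl
∈-listsUpTo full (suc r) []       _       = here refl
∈-listsUpTo full (suc r) (y ∷ ys) (s≤s le) = there (∈-cartesianProductWith⁺ _∷_ (full y) (∈-listsUpTo full r ys le))

length-listsUpTo : ∀ {A : Set} r (xs : List A) → length (listsUpTo r xs) ≤ suc (length xs) ^ r
length-listsUpTo zero    xs = ≤-refl
length-listsUpTo (suc r) xs = begin
  1 + length (cartesianProductWith _∷_ xs (listsUpTo r xs))  ≡⟨ cong suc (length-cartesianProductWith _∷_ xs (listsUpTo r xs)) ⟩
  1 + length xs * length (listsUpTo r xs)                    ≤⟨ +-mono-≤ (m^n>0 (suc (length xs)) r) (*-monoʳ-≤ (length xs) (length-listsUpTo r xs)) ⟩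
  suc (length xs) ^ suc r                                    ∎
  where open ≤-Reasoning

∣tabulate∣ : ∀ {n} {A : Set} (g : Fin n → A) (p : A → Bool) → ∣ Vec.tabulate (p ∘ g) ∣ ≡ ∑ (List.tabulate g) (𝟙 ∘ p)
∣tabulate∣ {zero}  g p = refl
∣tabulate∣ {suc n} g p with p (g zero)
... | true  = cong suc (∣tabulate∣ (g ∘ suc) p)
... | false = ∣tabulate∣ (g ∘ suc) p

subset-of-size : ∀ {n} (p : Subset n) k → k ≤ ∣ p ∣ → ∃[ q ] (q ⊆ p × ∣ q ∣ ≡ k)
subset-of-size []          zero    _ = [] , (λ ()) , refl
subset-of-size (true ∷ p)  (suc k) (s≤s le) with subset-of-size p k le
... | q , q⊆p , eq = true ∷ q , (λ { Vec.here → Vec.here ; (Vec.there v∈) → Vec.there (q⊆p v∈) }) , cong suc eq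
subset-of-size (true ∷ p)  zero    le with subset-of-size p zero z≤n
... | q , q⊆p , eq = false ∷ q , (λ { (Vec.there v∈) → Vec.there (q⊆p v∈) }) , eq
subset-of-size (false ∷ p) k       le with subset-of-size p k le
... | q , q⊆p , eq = false ∷ q , (λ { (Vec.there v∈) → Vec.there (q⊆p v∈) }) , eq

true≢false : true ≢ false
true≢false ()

holds : ∀ {P : Set} (P? : Dec P) → does P? ≡ true → P
holds (yes p) _ = p

1≤𝟙-does : ∀ {P : Set} (P? : Dec P) → P → 1 ≤ 𝟙 (does P?)
1≤𝟙-does (yes _) _ = ≤-refl
1≤𝟙-does (no ¬p) p = ⊥-elim (¬p p)

equal-bits : ∀ b b' → ¬ (b ≡ false × b' ≡ true) → ¬ (b ≡ true × b' ≡ false) → b ≡ b'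
equal-bits true  true  _ _ = refl
equal-bits false false _ _ = refl
equal-bits false true  h _ = ⊥-elim (h (refl , refl))
equal-bits true  false _ h = ⊥-elim (h (refl , refl))

not-true : ∀ {b} → not b ≡ true → b ≡ false
not-true {false} _ = refl

agreeOff-sym : ∀ {k} (h x x' : Vec Bool k) → AgreeOff h x x' → AgreeOff h x' x
agreeOff-sym []      []      []        _          = tt
agreeOff-sym (_ ∷ h) (_ ∷ x) (_ ∷ x') (ag , ags) = (sym ∘ ag) , agreeOff-sym h x x' ags

agreeOff-lookup : ∀ {k} (h x x' : Vec Bool k) → AgreeOff h x x' → ∀ r → lookup h r ≡ false → lookup x r ≡ lookup x' r
agreeOff-lookup (_ ∷ h) (_ ∷ x) (_ ∷ x') (ag , _)  zero    = ag
agreeOff-lookup (_ ∷ h) (_ ∷ x) (_ ∷ x') (_ , ags) (suc r) = agreeOff-lookup h x x' ags r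

lookup-ext : ∀ {k} (x x' : Vec Bool k) → (∀ r → lookup x r ≡ lookup x' r) → x ≡ x'
lookup-ext []      []        _  = refl
lookup-ext (b ∷ x) (b' ∷ x') eq = cong₂ _∷_ (eq zero) (lookup-ext x x' (eq ∘ suc))

cube>0 : ∀ {k} (h : Vec Bool k) → 0 < cube h
cube>0 []          = s≤s z≤n
cube>0 (true ∷ h)  = cube>0 h
cube>0 (false ∷ h) = ≤-trans (cube>0 h) (m≤m+n _ _)

-- Additive form of `cube (b ∷ h) = (2 - 𝟙 b) * cube h`.
cube-∷ : ∀ {k} b (h : Vec Bool k) → cube (b ∷ h) + cube h * 𝟙 b ≡ 2 * cube h
cube-∷ true  h = cong (cube h +_) (*-comm (cube h) 1)
cube-∷ false h = trans (cong (2 * cube h +_) (*-zeroʳ (cube h))) (+-identityʳ _)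

^-distribʳ-* : ∀ k a b → (a * b) ^ k ≡ a ^ k * b ^ k
^-distribʳ-* zero    a b = refl
^-distribʳ-* (suc k) a b rewrite ^-distribʳ-* k a b = ring a b (a ^ k) (b ^ k)
  where
  ring : ∀ a b x y → a * b * (x * y) ≡ a * x * (b * y)
  ring = solve-∀

-- Brings the lower bound `m / C` for the size of a set into the form that the expansion condition
-- asks for.
root-power : ∀ C m u k {l} → l ≡ suc k → 0 < m → C ^ l ≤ m → m ≤ C * u → m ^ k ≤ u ^ l
root-power C m u k refl m>0 C≤ m≤ = *-cancelˡ-≤ m {{>-nonZero m>0}} (begin
  m ^ suc k              ≤⟨ ^-monoˡ-≤ (suc k) m≤ ⟩
  (C * u) ^ suc k        ≡⟨ ^-distribʳ-* (suc k) C u ⟩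
  C ^ suc k * u ^ suc k  ≤⟨ *-monoˡ-≤ (u ^ suc k) C≤ ⟩
  m * u ^ suc k          ∎)
  where open ≤-Reasoning

-- ExpansionCond is the case k = 999, l = 1000.
Expansion : ∀ {n} → BTBG n → ℕ → ℕ → Set
Expansion H k l = ∀ U V → U ⊆ Roots H → V ⊆ Roots H → (∀ x → x ∈ U → x ∉ V) →
  nroots H ^ k ≤ ∣ U ∣ ^ l → nroots H ^ k ≤ ∣ V ∣ ^ l →
  ∃[ M ] (PseudomatchingBetween H U V M × nroots H ^ k ≤ (3 * length M) ^ l)

-- Greedy choice of pseudoedges and the counting argument

module Contradiction {n : ℕ} (H : BTBG n) (κ κ' : ℕ) (κ'≡ : κ' ≡ suc κ) (expansion : Expansion H κ κ')
  (Z : NBP n) (d : ℕ) (dnbp : IsDNBP Z d) (computes : Computes Z (Phi H))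
  (occ : Fin (size Z) → Fin (size Z) → Fin n → Bool)
  (occ-sound : ∀ p q v → occ p q v ≡ true → Σ (Program.Route Z p q) λ P → Program.Reads Z P v)
  (occ-complete : ∀ {p q} v (P : Program.Route Z p q) → Program.Reads Z P v → occ p q v ≡ true)
  (m>1 : 1 < nroots H)
  (t : ℕ) (t>0 : 0 < t) (t-small : 18 * suc d * t ≤ nroots H) (t-large : nroots H ≤ 36 * suc d * t)
  (r₀ D₀ D q' : ℕ) (r₀-large : 36 * suc d * suc d ≤ r₀) (D₀-large : 18 * 2 ^ (d + d) ≤ D₀) (D≡ : D ≡ 2 * D₀)
  where

  open Forest H
  open PEdge
  open Program Z
  open Occurrences occ occ-sound occ-complete

  m>0 : 0 < m
  m>0 = <⇒≤ m>1

  -- The roots are split once and for all into a left and a right half; the sets U and V of a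
  -- trace are taken inside them, which keeps them disjoint even for variables that are never read.
  half : ∃[ p ] (p ⊆ Roots H × ∣ p ∣ ≡ ⌊ m /2⌋)
  half = subset-of-size (Roots H) ⌊ m /2⌋ (⌊n/2⌋≤n m)

  isL isR : Fin n → Bool
  isL v = lookup (proj₁ half) v
  isR v = lookup (Roots H) v ∧ not (isL v)

  L R : List (Fin n)
  L = filterᵇ isL (allFin n)
  R = filterᵇ isR (allFin n)

  length-filterᵇ : ∀ (p : Fin n → Bool) → length (filterᵇ p (allFin n)) ≡ ∣ Vec.tabulate p ∣
  length-filterᵇ p = begin
    length (filterᵇ p (allFin n))            ≡⟨ ∑-1 (filterᵇ p (allFin n)) ⟨
    ∑ (filterᵇ p (allFin n)) (λ _ → 1)       ≡⟨ ∑-filterᵇ p (allFin n) _ ⟩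
    ∑ (allFin n) (λ v → 𝟙 (p v) * 1)         ≡⟨ ∑-cong (allFin n) (λ v → *-identityʳ (𝟙 (p v))) ⟩
    ∑ (allFin n) (𝟙 ∘ p)                     ≡⟨ ∣tabulate∣ id p ⟨
    ∣ Vec.tabulate p ∣                       ∎
    where open ≡-Reasoning

  length-L : length L ≡ ⌊ m /2⌋
  length-L = trans (length-filterᵇ isL) (trans (cong ∣_∣ (Vec.tabulate∘lookup (proj₁ half))) (proj₂ (proj₂ half)))

  isL-root : ∀ v → isL v ≡ true → lookup (Roots H) v ≡ true
  isL-root v eq = []=⇒lookup (proj₁ (proj₂ half) (lookup⇒[]= v (proj₁ half) eq))

  isR-not-isL : ∀ v → isL v ≡ true → isR v ≡ false
  isR-not-isL v eq rewrite eq with lookup (Roots H) v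
  ... | true  = refl
  ... | false = refl

  sizes : length L + length R ≡ m
  sizes = begin
    length L + length R                            ≡⟨ cong₂ _+_ (trans (length-filterᵇ isL) (∣tabulate∣ id isL)) (trans (length-filterᵇ isR) (∣tabulate∣ id isR)) ⟩
    ∑ (allFin n) (𝟙 ∘ isL) + ∑ (allFin n) (𝟙 ∘ isR)  ≡⟨ ∑-+ (allFin n) _ _ ⟨
    ∑ (allFin n) (λ v → 𝟙 (isL v) + 𝟙 (isR v))     ≡⟨ ∑-cong (allFin n) point ⟩
    ∑ (allFin n) (𝟙 ∘ lookup (Roots H))            ≡⟨ ∣tabulate∣ id (lookup (Roots H)) ⟨
    ∣ Vec.tabulate (lookup (Roots H)) ∣            ≡⟨ cong ∣_∣ (Vec.tabulate∘lookup (Roots H)) ⟩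
    m ∎
    where
    open ≡-Reasoning
    point : ∀ v → 𝟙 (isL v) + 𝟙 (isR v) ≡ 𝟙 (lookup (Roots H) v)
    point v with isL v in l | lookup (Roots H) v in r
    ... | true  | true  = refl
    ... | false | true  = refl
    ... | false | false = refl
    ... | true  | false with trans (sym r) (isL-root v l)
    ...   | ()

  balanced : m * m ≤ 9 * (length L * length R)
  balanced = subst₂ (λ a b → m * m ≤ 9 * (a * b)) (sym length-L)
    (+-cancelˡ-≡ (length L) _ _ (trans (trans (cong (_+ ⌈ m /2⌉) length-L) (⌊n/2⌋+⌈n/2⌉≡n m)) (sym sizes)))
    (bound m m>1)
    where
    near : ∀ k k' → 1 ≤ k → k ≤ k' → k' ≤ suc k → (k + k') * (k + k') ≤ 9 * (k * k')
    near k k' 1≤k k≤k' k'≤ = begin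
      (k + k') * (k + k')                       ≡⟨ r₁ k k' ⟩
      k * k + 2 * (k * k') + k' * k'            ≤⟨ +-mono-≤ (+-monoˡ-≤ (2 * (k * k')) (*-monoʳ-≤ k k≤k'))
                                                    (*-monoˡ-≤ k' (≤-trans k'≤ (+-monoˡ-≤ k 1≤k))) ⟩
      k * k' + 2 * (k * k') + (k + k) * k'      ≤⟨ m≤m+n _ (4 * (k * k')) ⟩
      k * k' + 2 * (k * k') + (k + k) * k' + 4 * (k * k')   ≡⟨ r₂ k k' ⟩
      9 * (k * k') ∎
      where
      open ≤-Reasoning
      r₁ : ∀ k k' → (k + k') * (k + k') ≡ k * k + 2 * (k * k') + k' * k'
      r₁ = solve-∀
      r₂ : ∀ k k' → k * k' + 2 * (k * k') + (k + k) * k' + 4 * (k * k') ≡ 9 * (k * k')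
      r₂ = solve-∀
    bound : ∀ m → 1 < m → m * m ≤ 9 * (⌊ m /2⌋ * ⌈ m /2⌉)
    bound m m>1 = subst (λ x → x * x ≤ 9 * (⌊ m /2⌋ * ⌈ m /2⌉)) (⌊n/2⌋+⌈n/2⌉≡n m)
      (near ⌊ m /2⌋ ⌈ m /2⌉ (⌊n/2⌋-mono m>1) (⌊n/2⌋≤⌈n/2⌉ m) (⌊n/2⌋-mono (n≤1+n (suc m))))

  L≤m : length L ≤ m
  L≤m = ≤-trans (m≤m+n _ (length R)) (≤-reflexive sizes)

  R≤m : length R ≤ m
  R≤m = ≤-trans (m≤n+m _ (length L)) (≤-reflexive sizes)

  L-unique : Unique L
  L-unique = Unique.filter⁺ (T? ∘ isL) (Unique.allFin⁺ n)

  R-unique : Unique R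
  R-unique = Unique.filter⁺ (T? ∘ isR) (Unique.allFin⁺ n)

  open Rectangle d dnbp L R L-unique m t t>0 sizes balanced t-small t-large r₀ D₀ r₀-large D₀-large

  C Q : ℕ
  C  = 2 * (D * D)
  Q  = suc q'

  variables : List (Maybe (Fin n))
  variables = nothing ∷ map just (allFin n)

  items : List (Block × Bool)
  items = cartesianProduct (cartesianProduct (allFin (size Z)) (cartesianProduct (allFin (size Z)) variables))
            (true ∷ false ∷ [])

  ∈-items : ∀ x → x LM.∈ items
  ∈-items ((p , q , x) , c) = ∈-cartesianProduct⁺
    (∈-cartesianProduct⁺ (∈-allFin p) (∈-cartesianProduct⁺ (∈-allFin q) (var x))) (colour c)
    where
    var : ∀ x → x LM.∈ variables
    var nothing  = here refl
    var (just x) = there (∈-map⁺ just (∈-allFin x))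
    colour : ∀ c → c LM.∈ (true ∷ false ∷ [])
    colour true  = here refl
    colour false = there (here refl)

  length-items : length items ≡ size Z * (size Z * suc n) * 2
  length-items = begin
    length items                                             ≡⟨ length-cartesianProductWith _,_ ppv (true ∷ false ∷ []) ⟩
    length ppv * 2                                           ≡⟨ cong (_* 2) (length-cartesianProductWith _,_ ps pv) ⟩
    length ps * length pv * 2                                ≡⟨ cong (λ x → length ps * x * 2) (length-cartesianProductWith _,_ ps variables) ⟩
    length ps * (length ps * suc (length (map just vs))) * 2 ≡⟨ cong₂ (λ x y → x * (x * suc y) * 2) (length-tabulate {n = size Z} id)
                                                                  (trans (length-map just vs) (length-tabulate {n = n} id)) ⟩
    size Z * (size Z * suc n) * 2                            ∎
    where
    open ≡-Reasoning
    vs  = allFin n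
    ps  = allFin (size Z)
    pv  = cartesianProduct ps variables
    ppv = cartesianProduct ps pv

  big? : ∀ tr → Dec (m * m ≤ D₀ * area tr)
  big? tr = m * m ≤? D₀ * area tr

  -- All candidates of bounded length with a large rectangle, whether or not they come from a path.
  Ω : List Trace
  Ω = filter big? (listsUpTo r₀ items)

  ∈-Ω : ∀ tr → length tr ≤ r₀ → m * m ≤ D₀ * area tr → tr LM.∈ Ω
  ∈-Ω tr short big = ∈-filter⁺ big? (∈-listsUpTo ∈-items r₀ tr short) big

  length-Ω : length Ω ≤ suc (size Z * (size Z * suc n) * 2) ^ r₀
  length-Ω = ≤-trans (length-filter big? (listsUpTo r₀ items))
    (subst (λ x → length (listsUpTo r₀ items) ≤ suc x ^ r₀) length-items (length-listsUpTo r₀ items))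

  U₀ V₀ : Trace → Fin n → Bool
  U₀ α v = isL v ∧ avoids false α v
  V₀ α v = isR v ∧ avoids true α v

  hit : ∀ {k} → Trace → Vec PEdge k → Vec Bool k
  hit α = hits (U₀ α) (V₀ α)

  -- The potential of the greedy choice: the summand of `α` bounds the number of points of the cube
  -- that the trace `α` can serve.
  W : ∀ {k} → Vec PEdge k → ℕ
  W K = ∑ Ω (λ α → cube (hit α K))

  used : ∀ {k} → Vec PEdge k → Fin n → Bool
  used []      v = false
  used (e ∷ K) v = (is (just (a e)) v ∨ is (just (b e)) v) ∨ used K v

  used-end : ∀ {k} (K : Vec PEdge k) r v → End (lookup K r) v → used K v ≡ true
  used-end (e ∷ K) zero _ (inj₁ refl) rewrite is-just (a e) = refl
  used-end (e ∷ K) zero _ (inj₂ refl) rewrite is-just (b e) with is (just (a e)) (b e)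
  ... | true  = refl
  ... | false = refl
  used-end (e ∷ K) (suc r) v end rewrite used-end K r v end with is (just (a e)) v ∨ is (just (b e)) v
  ... | true  = refl
  ... | false = refl

  used-few : ∀ {k} (K : Vec PEdge k) {xs} → Unique xs → ∑ xs (𝟙 ∘ used K) ≤ 2 * k
  used-few [] {xs} _ = ≤-reflexive (∑-0 xs)
  used-few {suc k} (e ∷ K) {xs} un = begin
    ∑ xs (𝟙 ∘ used (e ∷ K))
      ≤⟨ ∑-mono xs (λ v → 𝟙-∨₃ (is (just (a e)) v) (is (just (b e)) v) (used K v)) ⟩
    ∑ xs (λ v → 𝟙 (is (just (a e)) v) + 𝟙 (is (just (b e)) v) + 𝟙 (used K v))
      ≡⟨ trans (∑-+ xs _ _) (cong (_+ _) (∑-+ xs _ _)) ⟩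
    ∑ xs (λ v → 𝟙 (is (just (a e)) v)) + ∑ xs (λ v → 𝟙 (is (just (b e)) v)) + ∑ xs (𝟙 ∘ used K)
      ≤⟨ +-mono-≤ (+-mono-≤ (is-unique (just (a e)) un) (is-unique (just (b e)) un)) (used-few K un) ⟩
    2 + 2 * k   ≡⟨ *-suc 2 k ⟨
    2 * suc k   ∎
    where
    open ≤-Reasoning
    𝟙-∨₃ : ∀ a b c → 𝟙 ((a ∨ b) ∨ c) ≤ 𝟙 a + 𝟙 b + 𝟙 c
    𝟙-∨₃ true  b     c = s≤s z≤n
    𝟙-∨₃ false true  c = s≤s z≤n
    𝟙-∨₃ false false c = ≤-refl

  module _ {k} (K : Vec PEdge k) where

    U V : Trace → Fin n → Bool
    U α v = avoids false α v ∧ not (used K v)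
    V α v = avoids true α v ∧ not (used K v)

    unused-bound : ∀ xs (f : Fin n → Bool) → Unique xs →
      ∑ xs (𝟙 ∘ f) ≤ ∑ xs (λ v → 𝟙 (f v ∧ not (used K v))) + 2 * k
    unused-bound xs f un = ≤-trans (∑-mono xs (λ v → split (f v) (used K v)))
      (≤-trans (≤-reflexive (∑-+ xs _ _)) (+-monoʳ-≤ _ (used-few K un)))
      where
      split : ∀ a b → 𝟙 a ≤ 𝟙 (a ∧ not b) + 𝟙 b
      split false b     = z≤n
      split true  true  = s≤s z≤n
      split true  false = s≤s z≤n

    -- Removing the at most `2 * k` used roots from both sides costs at most `4 * k * m` pairs. As
    -- `8 * D₀ * k ≤ m`, this at most halves the guaranteed area, whence `D = 2 * D₀`.
    dense : 8 * D₀ * k ≤ m → ∀ α → α LM.∈ Ω → m * m ≤ D * (∑ L (λ u → 𝟙 (U α u)) * ∑ R (λ v → 𝟙 (V α v)))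
    dense k-small α α∈ = +-cancelʳ-≤ (m * m) _ _ (begin
      m * m + m * m                                ≤⟨ +-mono-≤ big big ⟩
      D₀ * (u * v) + D₀ * (u * v)                  ≡⟨ r₁ D₀ (u * v) ⟩
      2 * D₀ * (u * v)                             ≡⟨ cong (_* (u * v)) D≡ ⟨
      D * (u * v)                                  ≤⟨ *-monoʳ-≤ D (begin
        u * v                                        ≤⟨ *-monoˡ-≤ v (unused-bound L (avoids false α) L-unique) ⟩
        (u' + 2 * k) * v                             ≡⟨ *-distribʳ-+ v u' (2 * k) ⟩
        u' * v + 2 * k * v                           ≤⟨ +-mono-≤ (*-monoʳ-≤ u' (unused-bound R (avoids true α) R-unique))
                                                          (*-monoʳ-≤ (2 * k) (≤-trans (∑≤length R _) R≤m)) ⟩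
        u' * (v' + 2 * k) + 2 * k * m                ≡⟨ cong (_+ 2 * k * m) (trans (*-distribˡ-+ u' v' (2 * k)) (cong (u' * v' +_) (*-comm u' (2 * k)))) ⟩
        u' * v' + 2 * k * u' + 2 * k * m             ≤⟨ +-monoˡ-≤ (2 * k * m) (+-monoʳ-≤ (u' * v') (*-monoʳ-≤ (2 * k) (≤-trans (∑≤length L _) L≤m))) ⟩
        u' * v' + 2 * k * m + 2 * k * m              ∎) ⟩
      D * (u' * v' + 2 * k * m + 2 * k * m)        ≡⟨ trans (cong (_* (u' * v' + 2 * k * m + 2 * k * m)) D≡) (trans (r₂ D₀ (u' * v') k m)
                                                        (cong (λ z → z * (u' * v') + 8 * D₀ * k * m) (sym D≡))) ⟩
      D * (u' * v') + 8 * D₀ * k * m               ≤⟨ +-monoʳ-≤ (D * (u' * v')) (*-monoˡ-≤ m k-small) ⟩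
      D * (u' * v') + m * m                        ∎)
      where
      open ≤-Reasoning
      u v u' v' : ℕ
      u  = ∑ L (λ u → 𝟙 (avoids false α u))
      v  = ∑ R (λ v → 𝟙 (avoids true α v))
      u' = ∑ L (λ u → 𝟙 (U α u))
      v' = ∑ R (λ v → 𝟙 (V α v))
      big : m * m ≤ D₀ * (u * v)
      big = proj₂ (∈-filter⁻ big? {xs = listsUpTo r₀ items} α∈)
      r₁ : ∀ D x → D * x + D * x ≡ 2 * D * x
      r₁ = solve-∀
      r₂ : ∀ D x k m → 2 * D * (x + 2 * k * m + 2 * k * m) ≡ 2 * D * x + 8 * D * k * m
      r₂ = solve-∀

  -- `m ^ κ` is positive, so the pseudomatching between the two sets is not empty.
  edge-between : ∀ A B → A ⊆ Roots H → B ⊆ Roots H → (∀ x → x ∈ A → x ∉ B) →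
    m ^ κ ≤ ∣ A ∣ ^ κ' → m ^ κ ≤ ∣ B ∣ ^ κ' → Σ PEdge λ e → a e ∈ A × b e ∈ B
  edge-between A B A⊆ B⊆ disjoint bigA bigB with expansion A B A⊆ B⊆ disjoint bigA bigB
  ... | [] , _ , none = ⊥-elim (<⇒≱ (subst (λ l → 0 < 0 ^ l) κ'≡ (≤-trans (m^n>0 m {{>-nonZero m>0}} κ) none)) z≤n)
  ... | (_ , _) ∷ _ , ((((i , j , (i≢j , ℓ , li , lj) , refl , refl) ∷ _) , _) , ((a∈ , b∈) ∷ _)) , _ =
    record { i = i ; j = j ; i≢j = i≢j ; ℓ = ℓ ; leafᵢ = li ; leafⱼ = lj } , a∈ , b∈

  module _ (C-small : C ^ κ' ≤ m) (Q-large : C * m ≤ Q * Q) where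

    -- The new edge joins the two sides of a rich rectangle, so at least `1 / Q` of the weight
    -- belongs to traces it hits. A hit trace keeps its weight and any other doubles it, which gives
    -- the factor `2 - 1 / Q`, with `Q = 1 + q'`.
    extend : ∀ {k} (K : Vec PEdge k) → Distinct K → 8 * D₀ * k ≤ m → 0 < W K →
      Σ PEdge λ e → Distinct (e ∷ K) × Q * W (e ∷ K) ≤ (1 + 2 * q') * W K
    extend K distinct k-small W>0 = choose rich-rectangle
      where
      open Choice Ω (λ α → cube (hit α K)) (U K) (V K) L R m D Q L≤m R≤m m>0 (dense K k-small) Q-large W>0
        using (π; rich-rectangle)

      indicator : (f g : Fin n → Bool) → Subset n
      indicator f g = Vec.tabulate (λ v → f v ∧ g v)

      ∈-indicator : ∀ f g {v} → v ∈ indicator f g → f v ≡ true × g v ≡ true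
      ∈-indicator f g {v} v∈ = ∧-true (trans (sym (lookup∘tabulate _ v)) ([]=⇒lookup v∈))

      ∣indicator∣ : ∀ f g → ∣ indicator f g ∣ ≡ ∑ (filterᵇ f (allFin n)) (𝟙 ∘ g)
      ∣indicator∣ f g = trans (∣tabulate∣ id (λ v → f v ∧ g v))
        (trans (∑-cong (allFin n) (λ v → 𝟙-∧ (f v) (g v))) (sym (∑-filterᵇ f (allFin n) (𝟙 ∘ g))))

      large : ∀ f g → m ≤ C * ∑ (filterᵇ f (allFin n)) (𝟙 ∘ g) → m ^ κ ≤ ∣ indicator f g ∣ ^ κ'
      large f g le = root-power C m ∣ indicator f g ∣ κ κ'≡ m>0 C-small
        (subst (λ x → m ≤ C * x) (sym (∣indicator∣ f g)) le)

      choose : _ → _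
      choose (α , A , B , A⊆U , B⊆V , A-large , B-large , α∈ , frequent) =
        e , (a≢b , fresh , distinct) , bound
        where
        found : Σ PEdge λ e → a e ∈ indicator isL A × b e ∈ indicator isR B
        found = edge-between (indicator isL A) (indicator isR B)
          (λ {v} v∈ → lookup⇒[]= v (Roots H) (isL-root v (proj₁ (∈-indicator isL A v∈))))
          (λ {v} v∈ → lookup⇒[]= v (Roots H) (proj₁ (∧-true {lookup (Roots H) v} (proj₁ (∈-indicator isR B v∈)))))
          (λ v v∈A v∈B → true≢false (trans (sym (proj₁ (∈-indicator isR B v∈B))) (isR-not-isL v (proj₁ (∈-indicator isL A v∈A)))))
          (large isL A A-large) (large isR B B-large)
        e = proj₁ found
        La : isL (a e) ≡ true
        La = proj₁ (∈-indicator isL A (proj₁ (proj₂ found)))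
        Aa : A (a e) ≡ true
        Aa = proj₂ (∈-indicator isL A (proj₁ (proj₂ found)))
        Rb : isR (b e) ≡ true
        Rb = proj₁ (∈-indicator isR B (proj₂ (proj₂ found)))
        Bb : B (b e) ≡ true
        Bb = proj₂ (∈-indicator isR B (proj₂ (proj₂ found)))

        a≢b : a e ≢ b e
        a≢b eq = true≢false (trans (sym Rb) (trans (cong isR (sym eq)) (isR-not-isL (a e) La)))

        unused-a : used K (a e) ≡ false
        unused-a = not-true (proj₂ (∧-true {avoids false α (a e)} (A⊆U (a e) Aa)))
        unused-b : used K (b e) ≡ false
        unused-b = not-true (proj₂ (∧-true {avoids true α (b e)} (B⊆V (b e) Bb)))

        fresh : ∀ r v → End (lookup K r) v → ¬ End e v
        fresh r v end (inj₁ refl) = true≢false (trans (sym (used-end K r (a e) end)) unused-a)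
        fresh r v end (inj₂ refl) = true≢false (trans (sym (used-end K r (b e) end)) unused-b)

        hitW : ℕ
        hitW = ∑ Ω (λ β → cube (hit β K) * 𝟙 (U₀ β (a e) ∧ V₀ β (b e)))

        π≤hitW : π (a e) (b e) ≤ hitW
        π≤hitW = ∑-mono Ω (λ β → *-monoʳ-≤ (cube (hit β K)) (point β))
          where
          drop : ∀ x u y u' → 𝟙 (x ∧ u) * 𝟙 (y ∧ u') ≤ 𝟙 (x ∧ y)
          drop true  true  true  true  = ≤-refl
          drop true  true  true  false = z≤n
          drop true  true  false u'    = z≤n
          drop true  false y     u'    = z≤n
          drop false u     y     u'    = z≤n
          point : ∀ β → 𝟙 (U K β (a e)) * 𝟙 (V K β (b e)) ≤ 𝟙 (U₀ β (a e) ∧ V₀ β (b e))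
          point β = ≤-trans
            (drop (avoids false β (a e)) (not (used K (a e))) (avoids true β (b e)) (not (used K (b e))))
            (≤-reflexive (cong 𝟙 (sym (cong₂ _∧_ (cong (_∧ avoids false β (a e)) La) (cong (_∧ avoids true β (b e)) Rb)))))

        W-split : W (e ∷ K) + hitW ≡ 2 * W K
        W-split = trans (sym (∑-+ Ω _ _))
          (trans (∑-cong Ω (λ β → cube-∷ (U₀ β (a e) ∧ V₀ β (b e)) (hit β K))) (∑-*ˡ Ω 2 _))

        bound : Q * W (e ∷ K) ≤ (1 + 2 * q') * W K
        bound = +-cancelʳ-≤ (W K) _ _ (begin
          Q * W (e ∷ K) + W K            ≤⟨ +-monoʳ-≤ (Q * W (e ∷ K))
            (frequent (a e) (b e) (∈-filter⁺ (T? ∘ isR) (∈-allFin (b e)) (subst T (sym Rb) _)) Aa Bb) ⟩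
          Q * W (e ∷ K) + Q * π (a e) (b e)  ≤⟨ +-monoʳ-≤ (Q * W (e ∷ K)) (*-monoʳ-≤ Q π≤hitW) ⟩
          Q * W (e ∷ K) + Q * hitW       ≡⟨ *-distribˡ-+ Q (W (e ∷ K)) hitW ⟨
          Q * (W (e ∷ K) + hitW)         ≡⟨ cong (Q *_) W-split ⟩
          Q * (2 * W K)                  ≡⟨ ring q' (W K) ⟩
          (1 + 2 * q') * W K + W K       ∎)
          where
          open ≤-Reasoning
          ring : ∀ q w → (1 + q) * (2 * w) ≡ (1 + 2 * q) * w + w
          ring = solve-∀

    -- The member `α₀` keeps the potential positive, as the choice of the next edge requires.
    greedy : ∀ {α₀} → α₀ LM.∈ Ω → ∀ k → 8 * D₀ * k ≤ m →
      Σ (Vec PEdge k) λ K → Distinct K × Q ^ k * W K ≤ (1 + 2 * q') ^ k * length Ω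
    greedy α∈ zero    _     = [] , tt , ≤-reflexive (cong (1 *_) (∑-1 Ω))
    greedy {α₀} α∈ (suc k) small =
      let small'               = ≤-trans (*-monoʳ-≤ (8 * D₀) (n≤1+n k)) small
          K , distinct , bound = greedy α∈ k small'
          e , distinct' , step = extend K distinct small' (≤-trans (cube>0 (hit α₀ K)) (≤∑ (λ α → cube (hit α K)) α∈))
      in e ∷ K , distinct' , grow k (W K) (W (e ∷ K)) (length Ω) bound step
      where
      open ≤-Reasoning
      r₁ : ∀ q p w → q * p * w ≡ p * (q * w)
      r₁ = solve-∀
      r₂ : ∀ p c w → p * (c * w) ≡ c * (p * w)
      r₂ = solve-∀
      grow : ∀ k w w' ω → Q ^ k * w ≤ (1 + 2 * q') ^ k * ω → Q * w' ≤ (1 + 2 * q') * w →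
        Q ^ suc k * w' ≤ (1 + 2 * q') ^ suc k * ω
      grow k w w' ω bound step = begin
        Q * Q ^ k * w'                              ≡⟨ r₁ Q (Q ^ k) w' ⟩
        Q ^ k * (Q * w')                            ≤⟨ *-monoʳ-≤ (Q ^ k) step ⟩
        Q ^ k * ((1 + 2 * q') * w)                  ≡⟨ r₂ (Q ^ k) (1 + 2 * q') w ⟩
        (1 + 2 * q') * (Q ^ k * w)                  ≤⟨ *-monoʳ-≤ (1 + 2 * q') bound ⟩
        (1 + 2 * q') * ((1 + 2 * q') ^ k * ω)       ≡⟨ *-assoc (1 + 2 * q') ((1 + 2 * q') ^ k) ω ⟨
        (1 + 2 * q') ^ suc k * ω                    ∎

  module _ {k} (K : Vec PEdge k) (distinct : Distinct K) where

    record Accepting (x : Vec Bool k) : Set where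
      field
        tr     : Trace
        traced : Traced (assign K x) (map proj₁ tr)
        start  : head (map proj₁ tr) ≡ source Z
        tr∈Ω   : tr LM.∈ Ω
    open Accepting

    accepting : ∀ x → Accepting x
    accepting x =
      let P , _ , sat = Equivalence.to (computes (assign K x)) (phi-assign K x distinct)
          tr , traced , start , short , big = trace (assign K x) P sat
      in record { tr = tr ; traced = traced ; start = start ; tr∈Ω = ∈-Ω tr short big }

    -- The points differ at `r`, so the `r`-th edge is hit and its ends lie in `U₀ α` and `V₀ α`.
    -- Taking `x'` on `V₀ α` and `x` elsewhere makes both ends 0 and falsifies the clause, yet the
    -- program accepts this assignment along the spliced path.
    no-crossing : ∀ x x' (α : Trace) → Traced (assign K x) (map proj₁ α) → Traced (assign K x') (map proj₁ α) →
      head (map proj₁ α) ≡ source Z → AgreeOff (hit α K) x x' → ∀ r → lookup x r ≡ false → lookup x' r ≡ true → ⊥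
    no-crossing x x' α T T' start agree r xr x'r =
      clause-falsified K x x' r y mixed ya yb (Equivalence.from (computes y)
        (proj₁ route , computational , proj₂ route))
      where
      e = lookup K r

      y : Fin n → Bool
      y v = if V₀ α v then assign K x' v else assign K x v

      mixed : ∀ v → y v ≡ assign K x v ⊎ y v ≡ assign K x' v
      mixed v with V₀ α v
      ... | true  = inj₂ refl
      ... | false = inj₁ refl

      is-hit : U₀ α (a e) ∧ V₀ α (b e) ≡ true
      is-hit with U₀ α (a e) ∧ V₀ α (b e) in eq
      ... | true  = refl
      ... | false with trans (sym xr) (trans (agreeOff-lookup (hit α K) x x' agree r (trans (Vec.lookup-map r _ K) eq)) x'r)
      ...   | ()

      ya : y (a e) ≡ false
      ya rewrite isR-not-isL (a e) (proj₁ (∧-true {isL (a e)} (proj₁ (∧-true {U₀ α (a e)} is-hit)))) =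
        trans (assign-a K x distinct r) xr

      yb : y (b e) ≡ false
      yb rewrite proj₂ (∧-true {U₀ α (a e)} is-hit) = trans (assign-b K x' distinct r) (cong not x'r)

      from-true : ∀ v → avoids true α v ≡ false → y v ≡ assign K x v
      from-true v eq rewrite eq with isR v
      ... | true  = refl
      ... | false = refl

      -- A variable read in a block of colour `false` lies outside `U₀ α`. If it is also outside
      -- `V₀ α`, the two assignments coincide there.
      from-false : ∀ v → avoids false α v ≡ false → y v ≡ assign K x' v
      from-false v eq with V₀ α v in eq'
      ... | true  = refl
      ... | false = assign-agree K (U₀ α) (V₀ α) x x' agree v outside eq'
        where
        outside : U₀ α v ≡ false
        outside rewrite eq with isL v
        ... | true  = refl
        ... | false = refl

      route : Σ (SSPath Z) (Sat y)
      route = subst (λ p → Σ (Route p (sink Z)) (Sat y)) start (mix α T T' from-true from-false)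

      -- A path satisfied by an assignment cannot carry opposite literals.
      computational : Computational Z (proj₁ route)
      computational v (pos , neg) with trans (sym (All.lookup (proj₂ route) pos)) (All.lookup (proj₂ route) neg)
      ... | ()

    _≟ᵗ_ : DecidableEquality Trace
    _≟ᵗ_ = List.≡-dec (×-≡-dec (×-≡-dec _≟_ (×-≡-dec _≟_ (Maybe.≡-dec _≟_))) Bool._≟_)

    chosen : Trace → Vec Bool k → Bool
    chosen α x = does (tr (accepting x) ≟ᵗ α)

    separated : ∀ α → Separated (hit α K) (chosen α)
    separated α x x' p p' agree = lookup-ext x x' λ r → equal-bits _ _
        (λ (xr , x'r) → no-crossing x x' α T₁ T₂ begins agree r xr x'r)
        (λ (xr , x'r) → no-crossing x' x α T₂ T₁ begins (agreeOff-sym (hit α K) x x' agree) r x'r xr)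
      where
      eq : tr (accepting x) ≡ α
      eq = holds (tr (accepting x) ≟ᵗ α) p
      T₁ : Traced (assign K x) (map proj₁ α)
      T₁ = subst (λ α → Traced (assign K x) (map proj₁ α)) eq (traced (accepting x))
      T₂ : Traced (assign K x') (map proj₁ α)
      T₂ = subst (λ α → Traced (assign K x') (map proj₁ α)) (holds (tr (accepting x') ≟ᵗ α) p') (traced (accepting x'))
      begins : head (map proj₁ α) ≡ source Z
      begins = subst (λ α → head (map proj₁ α) ≡ source Z) eq (start (accepting x))

    -- Each point is served by the trace of its own path, and by separation a trace serves at most
    -- `cube (hit α K)` points.
    cubes-cover : 2 ^ k ≤ W K
    cubes-cover = begin
      2 ^ k                                         ≡⟨ ∑𝔹-1 k ⟨
      ∑𝔹 k (λ _ → 1)                                ≤⟨ ∑𝔹-mono k own ⟩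
      ∑𝔹 k (λ x → ∑ Ω (λ α → 𝟙 (chosen α x)))       ≡⟨ ∑𝔹-∑-swap k Ω (λ x α → 𝟙 (chosen α x)) ⟩
      ∑ Ω (λ α → ∑𝔹 k (λ x → 𝟙 (chosen α x)))       ≤⟨ ∑-mono Ω (λ α → separated-count (hit α K) (chosen α) (separated α)) ⟩
      W K                                           ∎
      where
      open ≤-Reasoning
      own : ∀ x → 1 ≤ ∑ Ω (λ α → 𝟙 (chosen α x))
      own x = ≤-trans (1≤𝟙-does (tr (accepting x) ≟ᵗ tr (accepting x)) refl)
        (≤∑ (λ α → 𝟙 (chosen α x)) (tr∈Ω (accepting x)))

  -- The greedy choice pushes `W K` down to `(2 - 1 / Q) ^ T * length Ω`, whereas covering the cube
  -- requires at least `2 ^ T`.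
  contradiction-at : C ^ κ' ≤ m → C * m ≤ Q * Q → ∀ T → 8 * D₀ * T ≤ m →
    ¬ ((1 + 2 * q') ^ T * suc (size Z * (size Z * suc n) * 2) ^ r₀ < (2 * Q) ^ T)
  contradiction-at C-small Q-large T T-small lt =
    let K , distinct , bound = greedy C-small Q-large (Accepting.tr∈Ω (accepting [] tt [])) T T-small
    in <⇒≱ lt (begin
      (2 * Q) ^ T                        ≡⟨ ^-distribʳ-* T 2 Q ⟩
      2 ^ T * Q ^ T                      ≡⟨ *-comm (2 ^ T) (Q ^ T) ⟩
      Q ^ T * 2 ^ T                      ≤⟨ *-monoʳ-≤ (Q ^ T) (cubes-cover K distinct) ⟩
      Q ^ T * W K                        ≤⟨ bound ⟩
      (1 + 2 * q') ^ T * length Ω        ≤⟨ *-monoʳ-≤ ((1 + 2 * q') ^ T) length-Ω ⟩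
      (1 + 2 * q') ^ T * suc (size Z * (size Z * suc n) * 2) ^ r₀  ∎)
    where open ≤-Reasoning

-- Integer roots and the choice of the parameters

^-cancel-< : ∀ k {a b} → a ^ k < b ^ k → a < b
^-cancel-< k {a} {b} lt = ≰⇒> λ b≤a → <⇒≱ lt (^-monoˡ-≤ k b≤a)

integer-root : ∀ k m → ∃[ z ] (z ^ suc k ≤ m × m < suc z ^ suc k)
integer-root k zero = 0 , z≤n , ≤-reflexive (sym (^-zeroˡ (suc k)))
integer-root k (suc m) with integer-root k m
... | z , lower , upper with suc z ^ suc k ≤? suc m
...   | yes le = suc z , le , ≤-<-trans upper (^-monoˡ-< (suc k) ≤-refl)
...   | no gt  = z , ≤-trans lower (n≤1+n m) , ≰⇒> gt

bernoulli : ∀ x k → (x + k) * x ^ k ≤ x * suc x ^ k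
bernoulli x zero    = ≤-reflexive (ring x)
  where
  ring : ∀ x → (x + 0) * 1 ≡ x * 1
  ring = solve-∀
bernoulli x (suc k) = begin
  (x + suc k) * (x * x ^ k)                      ≤⟨ m≤m+n _ (k * x ^ k) ⟩
  (x + suc k) * (x * x ^ k) + k * x ^ k          ≡⟨ r₁ x k (x ^ k) ⟩
  suc x * ((x + k) * x ^ k)                      ≤⟨ *-monoʳ-≤ (suc x) (bernoulli x k) ⟩
  suc x * (x * suc x ^ k)                        ≡⟨ r₂ x (suc x ^ k) ⟩
  x * (suc x * suc x ^ k)                        ∎
  where
  open ≤-Reasoning
  r₁ : ∀ x k p → (x + (1 + k)) * (x * p) + k * p ≡ (1 + x) * ((x + k) * p)
  r₁ = solve-∀
  r₂ : ∀ x p → (1 + x) * (x * p) ≡ x * ((1 + x) * p)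
  r₂ = solve-∀

-- Bernoulli's inequality for `(1 + 1 / (x + 1)) ^ (x + 2) ≥ 2`, with denominators cleared.
doubling : ∀ x → 2 * suc x ^ suc (suc x) ≤ suc (suc x) ^ suc (suc x)
doubling x = *-cancelˡ-≤ (suc x) (begin
  suc x * (2 * suc x ^ k)           ≡⟨ ring x (suc x ^ k) ⟩
  (suc x + suc x) * suc x ^ k       ≤⟨ *-monoˡ-≤ (suc x ^ k) (+-monoʳ-≤ (suc x) (n≤1+n (suc x))) ⟩
  (suc x + k) * suc x ^ k           ≤⟨ bernoulli (suc x) k ⟩
  suc x * suc (suc x) ^ k           ∎)
  where
  open ≤-Reasoning
  k = suc (suc x)
  ring : ∀ x p → (1 + x) * (2 * p) ≡ ((1 + x) + (1 + x)) * p
  ring = solve-∀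

-- With `Q = suc q'`, every `2 * Q` factors of `2 * Q / (2 * Q - 1)` multiply to at least 2, and `T`
-- consists of `s` such groups.
power-gap : ∀ q' s r → r < 2 ^ s → let T = 2 * suc q' * s in (1 + 2 * q') ^ T * r < (2 * suc q') ^ T
power-gap q' s r r< = begin-strict
  (1 + 2 * q') ^ (2 * suc q' * s) * r      ≡⟨ cong (_* r) (^-*-assoc (1 + 2 * q') (2 * suc q') s) ⟨
  (c ^ k) ^ s * r                          <⟨ *-monoʳ-< ((c ^ k) ^ s) {{>-nonZero (m^n>0 (c ^ k) {{m^n≢0 c k}} s)}} r< ⟩
  (c ^ k) ^ s * 2 ^ s                      ≡⟨ *-comm ((c ^ k) ^ s) (2 ^ s) ⟩
  2 ^ s * (c ^ k) ^ s                      ≡⟨ ^-distribʳ-* s 2 (c ^ k) ⟨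
  (2 * c ^ k) ^ s                          ≤⟨ ^-monoˡ-≤ s (subst (λ k → 2 * c ^ k ≤ k ^ k) (sym k≡) (doubling (2 * q'))) ⟩
  (k ^ k) ^ s                              ≡⟨ ^-*-assoc k k s ⟩
  k ^ (2 * suc q' * s)                     ∎
  where
  open ≤-Reasoning
  c k : ℕ
  c = suc (2 * q')
  k = 2 * suc q'
  k≡ : k ≡ suc (suc (2 * q'))
  k≡ = *-suc 2 q'

square-cancel : ∀ a b → a * a ≤ b * b → a ≤ b
square-cancel a b le = ≮⇒≥ λ b<a → <⇒≱ (*-mono-< b<a b<a) le

between : ∀ k m → 1 ≤ k → k ≤ m → ∃[ t ] (0 < t × k * t ≤ m × m ≤ k * t + k * t)
between k@(suc _) m _ k≤m = t , t>0 ,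
  ≤-trans (m≤n+m (k * t) (m % k)) (≤-reflexive (sym m≡)) ,
  ≤-trans (≤-reflexive m≡) (+-monoˡ-≤ (k * t) (≤-trans (<⇒≤ (m%n<n m k)) (m≤m*n k t {{>-nonZero t>0}})))
  where
  t = m / k
  m≡ : m ≡ m % k + k * t
  m≡ = trans (m≡m%n+[m/n]*n m k) (cong (m % k +_) (*-comm t k))
  t>0 : 0 < t
  t>0 with t in eq
  ... | suc _ = s≤s z≤n
  ... | zero  = ⊥-elim (<⇒≱ (m%n<n m k) (≤-trans k≤m (≤-reflexive (trans m≡
                  (trans (cong (λ t → m % k + k * t) eq) (trans (cong (m % k +_) (*-zeroʳ k)) (+-identityʳ _)))))))

x≤x^[1+k] : ∀ x k → 1 ≤ x → x ≤ x ^ suc k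
x≤x^[1+k] x k x≥1 = ≤-trans (≤-reflexive (sym (*-identityʳ x))) (*-monoʳ-≤ x (m^n>0 x {{>-nonZero x≥1}} k))

polynomial-gap : ∀ m Y → m < Y → m * (m * (m + 3)) < Y ^ 4
polynomial-gap m Y m<Y = <-≤-trans (≤-trans (≤-reflexive (+-comm 1 (m * (m * (m + 3))))) (≤-trans (+-monoˡ-≤ 1 (m≤m+n _ (m * m * m * m + 3 * m * m * m + 3 * m * m + 4 * m))) (≤-reflexive (ring m))))
  (^-monoˡ-≤ 4 m<Y)
  where
  ring : ∀ m → m * (m * (m + 3)) + (m * m * m * m + 3 * m * m * m + 3 * m * m + 4 * m) + 1 ≡ (1 + m) * ((1 + m) * ((1 + m) * ((1 + m) * 1)))
  ring = solve-∀

-- z is essentially the l-th root of the number m of roots (l = 100); every other quantity of the argument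
-- is bounded by a small power of it.
module Scale (m d z l κ b K₀ K₂ K : ℕ) (l-large : 33 ≤ l) (m-large : z ^ l ≤ m)
  (z-large : 18 ≤ z) (z-large-κ : 2592 ^ κ ≤ z) (z-large-K : 4 * (K * K) ≤ z)
  (κ≡ : 4 * κ ≡ 250 * 16) (d-small : 2 ^ (250 * d) ≤ suc z)
  (b≤ : b + 4 ≤ K₀) (K₀≤ : K₀ * 36 + 1 ≤ K₂) (K₂≤ : 64 * 324 * K₂ ≤ K) where

  open ≤-Reasoning

  -- If the program has at most `2 ^ y` vertices, `2 ^ g` exceeds the number of possible entries of
  -- a trace, and `2 ^ s` the bound on the number of traces of length at most `r₀`.
  y e D₀ D C r₀ g s : ℕ
  y  = suc z
  e  = 2 ^ d
  D₀ = 18 * 2 ^ (d + d)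
  D  = 2 * D₀
  C  = 2 * (D * D)
  r₀ = 36 * suc d * suc d
  g  = y + (y + b * y) + 2
  s  = g * r₀ + 1

  z>0 : 0 < z
  z>0 = ≤-trans (s≤s z≤n) z-large

  y≤z² : y ≤ z * z
  y≤z² = begin
    1 + z     ≤⟨ +-monoˡ-≤ z z>0 ⟩
    z + z     ≡⟨ cong (z +_) (+-identityʳ z) ⟨
    2 * z     ≤⟨ *-monoˡ-≤ z (≤-trans (s≤s (s≤s z≤n)) z-large) ⟩
    z * z     ∎

  power≤m : ∀ k → k ≤ 33 → z ^ k ≤ m
  power≤m k k≤ = ≤-trans (^-monoʳ-≤ z {{>-nonZero z>0}} (≤-trans k≤ l-large)) m-large

  e>0 : 1 ≤ e
  e>0 = m^n>0 2 d

  e^250≤y : e ^ 250 ≤ y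
  e^250≤y = ≤-trans (≤-reflexive (trans (^-*-assoc 2 d 250) (cong (2 ^_) (*-comm d 250)))) d-small

  e^4≤y : e ^ 4 ≤ y
  e^4≤y = ≤-trans (^-monoʳ-≤ e {{>-nonZero e>0}} {4} {250} (s≤s (s≤s (s≤s (s≤s z≤n))))) e^250≤y

  suc-d≤y : suc d ≤ y
  suc-d≤y = ≤-trans (n<2^n d) (≤-trans (x≤x^[1+k] e 3 e>0) e^4≤y)

  e² : 2 ^ (d + d) ≡ e * e
  e² = ^-distribˡ-+-* 2 d d

  D₀² : D₀ * D₀ ≡ 324 * e ^ 4
  D₀² = trans (cong (λ x → (18 * x) * (18 * x)) e²) (ring e)
    where
    ring : ∀ e → (18 * (e * e)) * (18 * (e * e)) ≡ 324 * (e * (e * (e * (e * 1))))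
    ring = solve-∀

  s-bound : s ≤ K₂ * (y * y * y)
  s-bound = begin
    g * r₀ + 1                                ≤⟨ +-mono-≤ (*-mono-≤ g≤ r₀≤) (*-mono-≤ (*-mono-≤ y>0 y>0) y>0) ⟩
    (K₀ * y) * (36 * (y * y)) + y * y * y     ≡⟨ ring K₀ 36 y ⟩
    (K₀ * 36 + 1) * (y * y * y)               ≤⟨ *-monoˡ-≤ (y * y * y) K₀≤ ⟩
    K₂ * (y * y * y)                          ∎
    where
    y>0 : 1 ≤ y
    y>0 = s≤s z≤n
    ring : ∀ a k y → (a * y) * (k * (y * y)) + y * y * y ≡ (a * k + 1) * (y * y * y)
    ring = solve-∀
    g≤ : g ≤ K₀ * y
    g≤ = begin
      y + (y + b * y) + 2        ≤⟨ +-monoʳ-≤ (y + (y + b * y)) (*-monoʳ-≤ 2 y>0) ⟩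
      y + (y + b * y) + 2 * y    ≡⟨ r y b ⟩
      (b + 4) * y                ≤⟨ *-monoˡ-≤ y b≤ ⟩
      K₀ * y                     ∎
      where
      r : ∀ y b → y + (y + b * y) + 2 * y ≡ (b + 4) * y
      r = solve-∀
    r₀≤ : r₀ ≤ 36 * (y * y)
    r₀≤ = ≤-trans (≤-reflexive (*-assoc 36 (suc d) (suc d))) (*-monoʳ-≤ 36 (*-mono-≤ suc-d≤y suc-d≤y))

  scaled : 64 * (D₀ * D₀) * s ≤ K * (y * y * y * y)
  scaled = begin
    64 * (D₀ * D₀) * s                        ≡⟨ cong (λ x → 64 * x * s) D₀² ⟩
    64 * (324 * e ^ 4) * s                    ≤⟨ *-mono-≤ (*-monoʳ-≤ 64 (*-monoʳ-≤ 324 e^4≤y)) s-bound ⟩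
    64 * (324 * y) * (K₂ * (y * y * y))       ≡⟨ ring 64 324 K₂ y ⟩
    64 * 324 * K₂ * (y * y * y * y)           ≤⟨ *-monoˡ-≤ (y * y * y * y) K₂≤ ⟩
    K * (y * y * y * y)                       ∎
    where
    ring : ∀ a b c y → a * (b * y) * (c * (y * y * y)) ≡ a * b * c * (y * y * y * y)
    ring = solve-∀

  -- For `Q = 2 * D * q` and `T = 2 * Q * s` the left side is `64 * (D₀ * D₀) * s * q`. As `q` is
  -- about the square root of `m`, squares are compared, and `z ^ 17 ≤ m` remains.
  T-bound : ∀ q → q * q ≤ 4 * m → 8 * D₀ * (2 * (2 * D * q) * s) ≤ m
  T-bound q q²≤ = square-cancel _ _ (begin
    8 * D₀ * (2 * (2 * D * q) * s) * (8 * D₀ * (2 * (2 * D * q) * s))   ≡⟨ r₁ D₀ q s ⟩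
    x * x * (q * q)                        ≤⟨ *-mono-≤ (*-mono-≤ scaled scaled) q²≤ ⟩
    K * y⁴ * (K * y⁴) * (4 * m)              ≡⟨ r₂ K y⁴ m ⟩
    4 * (K * K) * (y⁴ * y⁴) * m              ≤⟨ *-monoˡ-≤ m (*-mono-≤ z-large-K (*-mono-≤ y⁴≤ y⁴≤)) ⟩
    z * (z⁸ * z⁸) * m                        ≡⟨ cong (λ x → z * x * m) (sym (^-distribˡ-+-* z 8 8)) ⟩
    z ^ 17 * m                             ≤⟨ *-monoˡ-≤ m (power≤m 17 (m≤m+n 17 16)) ⟩
    m * m                                  ∎)
    where
    x y⁴ z⁸ : ℕ
    x = 64 * (D₀ * D₀) * s
    y⁴ = y * y * y * y
    z⁸ = z ^ 8
    r₃ : ∀ z → (z * z) * (z * z) * (z * z) * (z * z) ≡ z * (z * (z * (z * (z * (z * (z * (z * 1)))))))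
    r₃ = solve-∀
    y⁴≤ : y⁴ ≤ z⁸
    y⁴≤ = ≤-trans (*-mono-≤ (*-mono-≤ (*-mono-≤ y≤z² y≤z²) y≤z²) y≤z²) (≤-reflexive (r₃ z))
    r₁ : ∀ D q s → 8 * D * (2 * (2 * (2 * D) * q) * s) * (8 * D * (2 * (2 * (2 * D) * q) * s)) ≡
      64 * (D * D) * s * (64 * (D * D) * s) * (q * q)
    r₁ = solve-∀
    r₂ : ∀ K Y m → K * Y * (K * Y) * (4 * m) ≡ 4 * (K * K) * (Y * Y) * m
    r₂ = solve-∀

  -- `C` equals `2592 * e ^ 4`, and `4 * κ = 250 * 16` allows `e ^ 250 ≤ y` to be applied sixteen
  -- times.
  C-bound : C ^ κ ≤ m
  C-bound = begin
    C ^ κ                             ≡⟨ cong (_^ κ) (trans (r₁ D₀) (trans (cong (8 *_) D₀²) (r₂ (e ^ 4)))) ⟩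
    (2592 * e ^ 4) ^ κ                ≡⟨ ^-distribʳ-* κ 2592 (e ^ 4) ⟩
    2592 ^ κ * (e ^ 4) ^ κ            ≡⟨ cong (2592 ^ κ *_) (trans (^-*-assoc e 4 κ) (trans (cong (e ^_) κ≡) (sym (^-*-assoc e 250 16)))) ⟩
    2592 ^ κ * (e ^ 250) ^ 16         ≤⟨ *-mono-≤ z-large-κ (^-monoˡ-≤ 16 (≤-trans e^250≤y y≤z²)) ⟩
    z * (z * z) ^ 16                  ≡⟨ cong (z *_) (trans (^-distribʳ-* 16 z z) (sym (^-distribˡ-+-* z 16 16))) ⟩
    z ^ 33                            ≤⟨ power≤m 33 ≤-refl ⟩
    m                                 ∎
    where
    r₁ : ∀ D → 2 * ((2 * D) * (2 * D)) ≡ 8 * (D * D)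
    r₁ = solve-∀
    r₂ : ∀ x → 8 * (324 * x) ≡ 2592 * x
    r₂ x = sym (*-assoc 8 324 x)

  m>1 : 1 < m
  m>1 = ≤-trans (≤-trans (s≤s (s≤s z≤n)) z-large) (≤-trans (≤-reflexive (sym (^-identityʳ z))) (power≤m 1 (s≤s z≤n)))

  d-bound : 18 * suc d ≤ m
  d-bound = begin
    18 * suc d      ≤⟨ *-mono-≤ z-large (≤-trans suc-d≤y y≤z²) ⟩
    z * (z * z)     ≡⟨ ring z ⟩
    z ^ 3           ≤⟨ power≤m 3 (s≤s (s≤s (s≤s z≤n))) ⟩
    m               ∎
    where
    ring : ∀ z → z * (z * z) ≡ z * (z * (z * 1))
    ring = solve-∀

  near-root : ∃[ q ] (0 < q × m ≤ q * q × q * q ≤ 4 * m)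
  near-root with integer-root 1 m
  ... | zero  , _ , upper = ⊥-elim (<⇒≱ upper (<⇒≤ m>1))
  ... | r@(suc _) , lower , upper = suc r , s≤s z≤n , ≤-trans (<⇒≤ upper) (≤-reflexive (sq (suc r))) , (begin
    suc r * suc r              ≤⟨ *-mono-≤ r≤ r≤ ⟩
    (r + r) * (r + r)          ≡⟨ ring r ⟩
    4 * (r ^ 2)                ≤⟨ *-monoʳ-≤ 4 lower ⟩
    4 * m                      ∎)
    where
    r≤ : suc r ≤ r + r
    r≤ = +-monoˡ-≤ r (s≤s z≤n)
    sq : ∀ r → r * (r * 1) ≡ r * r
    sq = solve-∀
    ring : ∀ r → (r + r) * (r + r) ≡ 4 * (r * (r * 1))
    ring = solve-∀

  traces-bound : ∀ N n → N ≤ 2 ^ y → n < y ^ b → suc (N * (N * suc n) * 2) ^ r₀ < 2 ^ s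
  traces-bound N n N≤ n< = begin-strict
    suc (N * (N * suc n) * 2) ^ r₀   ≤⟨ ^-monoˡ-≤ r₀ base ⟩
    (2 ^ g) ^ r₀                     ≡⟨ ^-*-assoc 2 g r₀ ⟩
    2 ^ (g * r₀)                     <⟨ ^-monoʳ-< 2 (s≤s (s≤s z≤n)) (≤-reflexive (+-comm 1 (g * r₀))) ⟩
    2 ^ (g * r₀ + 1)                 ∎
    where
    suc-n≤ : suc n ≤ 2 ^ (b * y)
    suc-n≤ = begin
      suc n          ≤⟨ n< ⟩
      y ^ b          ≤⟨ ^-monoˡ-≤ b (<⇒≤ (n<2^n y)) ⟩
      (2 ^ y) ^ b    ≡⟨ trans (^-*-assoc 2 y b) (cong (2 ^_) (*-comm y b)) ⟩
      2 ^ (b * y)    ∎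
    h : ℕ
    h = y + (y + b * y)
    base : suc (N * (N * suc n) * 2) ≤ 2 ^ g
    base = begin
      suc (N * (N * suc n) * 2)                ≤⟨ s≤s (*-monoˡ-≤ 2 (*-mono-≤ N≤ (*-mono-≤ N≤ suc-n≤))) ⟩
      1 + 2 ^ y * (2 ^ y * 2 ^ (b * y)) * 2    ≡⟨ cong (λ x → 1 + x * 2) (trans (cong (2 ^ y *_) (sym (^-distribˡ-+-* 2 y (b * y)))) (sym (^-distribˡ-+-* 2 y (y + b * y)))) ⟩
      1 + 2 ^ h * 2                            ≤⟨ +-monoˡ-≤ (2 ^ h * 2) (≤-trans (m^n>0 2 h) (m≤m*n (2 ^ h) 2)) ⟩
      2 ^ h * 2 + 2 ^ h * 2                    ≡⟨ ring (2 ^ h) ⟩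
      2 ^ h * 2 ^ 2                            ≡⟨ ^-distribˡ-+-* 2 h 2 ⟨
      2 ^ g                                    ∎
      where
      ring : ∀ x → x * 2 + x * 2 ≡ x * 4
      ring = solve-∀

-- The lower bound on the size of the program

¬¬-∀Fin : ∀ {n} {A : Fin n → Set} → (∀ i → ¬ ¬ A i) → ¬ ¬ (∀ i → A i)
¬¬-∀Fin {zero}  _ k = k λ ()
¬¬-∀Fin {suc n} h k = h zero λ a → ¬¬-∀Fin (h ∘ suc) λ as → k λ { zero → a ; (suc i) → as i }

module Main (l' b κ κ' K₀ K₂ K E : ℕ) (33≤l : 33 ≤ suc l') (b≡ : b ≡ suc l' * 4) (κ'≡ : κ' ≡ suc κ)
  (4κ'≡ : 4 * κ' ≡ 250 * 16) (b≤ : b + 4 ≤ K₀) (K₀≤ : K₀ * 36 + 1 ≤ K₂) (K₂≤ : 64 * 324 * K₂ ≤ K)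
  (E≡ : E ≡ 250 * b) where

  -- The sum of the three lower bounds on `z` under which the estimates hold.
  Z₀ : ℕ
  Z₀ = 18 + (2592 ^ κ' + 4 * (K * K))

  module _ {n : ℕ} (n-large : Z₀ ^ b ≤ n) (H : BTBG n) (height : HeightCond H) (expansion : Expansion H κ κ')
    (d : ℕ) (d-small : 2 ^ (E * d) ≤ n) (Z : NBP n) (dnbp : IsDNBP Z d) (computes : Computes Z (Phi H)) where

    open ≤-Reasoning

    m z : ℕ
    m = nroots H
    z = proj₁ (integer-root l' m)

    -- `n` is less than `(m + 1) ^ 4`, `m` is less than `suc z ^ suc l'`, and `b` is four times this
    -- exponent.
    n<y^b : n < suc z ^ b
    n<y^b = begin-strict
      n                       ≤⟨ Forest.few-vertices H height ⟩
      m * (m * (m + 3))       <⟨ polynomial-gap m _ (proj₂ (proj₂ (integer-root l' m))) ⟩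
      (suc z ^ suc l') ^ 4    ≡⟨ ^-*-assoc (suc z) (suc l') 4 ⟩
      suc z ^ (suc l' * 4)    ≡⟨ cong (suc z ^_) b≡ ⟨
      suc z ^ b               ∎

    Z₀≤z : Z₀ ≤ z
    Z₀≤z = s≤s⁻¹ (^-cancel-< b (≤-<-trans n-large n<y^b))

    2^250d≤y : 2 ^ (250 * d) ≤ suc z
    2^250d≤y = <⇒≤ (^-cancel-< b (begin-strict
      (2 ^ (250 * d)) ^ b     ≡⟨ ^-*-assoc 2 (250 * d) b ⟩
      2 ^ (250 * d * b)       ≡⟨ cong (2 ^_) (trans (ring 250 d b) (cong (_* d) (sym E≡))) ⟩
      2 ^ (E * d)             ≤⟨ d-small ⟩
      n                       <⟨ n<y^b ⟩
      suc z ^ b               ∎))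
      where
      ring : ∀ c d b → c * d * b ≡ c * b * d
      ring = solve-∀

    open Scale m d z (suc l') κ' b K₀ K₂ K 33≤l (proj₁ (proj₂ (integer-root l' m)))
      (≤-trans (m≤m+n 18 _) Z₀≤z)
      (≤-trans (m≤m+n (2592 ^ κ') _) (≤-trans (m≤n+m _ 18) Z₀≤z))
      (≤-trans (m≤n+m (4 * (K * K)) (2592 ^ κ')) (≤-trans (m≤n+m _ 18) Z₀≤z))
      4κ'≡ 2^250d≤y b≤ K₀≤ K₂≤

    module Pr = Program Z

    not-small-decided : (∀ p q v → Dec (Σ (Pr.Route p q) λ P → Pr.Reads P v)) → ¬ (size Z ≤ 2 ^ y)
    not-small-decided occ? N≤ =
      let t , t>0 , t-small , t-large = between (18 * suc d) m (s≤s z≤n) d-bound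
          q , q>0 , m≤q² , q²≤4m      = near-root
      -- `Q` is taken as `2 * D * q`; its square is at least `2 * (D * D) * m` because `m ≤ q * q`.
      in at t t>0 t-small (≤-trans t-large (≤-reflexive (r₁ d t))) q (2 * D * q) refl m≤q² q²≤4m (positive q q>0)
      where
      r₁ : ∀ d t → 18 * (1 + d) * t + 18 * (1 + d) * t ≡ 36 * (1 + d) * t
      r₁ = solve-∀
      r₂ : ∀ D q → 2 * (D * D) * (2 * (q * q)) ≡ 2 * D * q * (2 * D * q)
      r₂ = solve-∀
      positive : ∀ q → 0 < q → 0 < 2 * D * q
      positive q q>0 = *-mono-≤ {1} {2 * D} (*-mono-≤ {1} {2} (s≤s z≤n) (*-mono-≤ {1} {2} (s≤s z≤n)
        (*-mono-≤ {1} {18} (s≤s z≤n) (m^n>0 2 (d + d))))) q>0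
      at : ∀ t → 0 < t → 18 * suc d * t ≤ m → m ≤ 36 * suc d * t →
        ∀ q Q → Q ≡ 2 * D * q → m ≤ q * q → q * q ≤ 4 * m → 0 < Q → ⊥
      at t t>0 t-small t-large q (suc q') Q≡ m≤q² q²≤4m _ =
        C.contradiction-at C-bound Q-large (2 * suc q' * s)
          (subst (λ Q → 8 * D₀ * (2 * Q * s) ≤ m) (sym Q≡) (T-bound q q²≤4m))
          (power-gap q' s _ (traces-bound (size Z) n N≤ n<y^b))
        where
        module C = Contradiction H κ κ' κ'≡ expansion Z d dnbp computes
          (λ p q v → does (occ? p q v)) (λ p q v → holds (occ? p q v)) (λ {p} {q} v P r → dec-true (occ? p q v) (P , r))
          m>1 t t>0 t-small t-large r₀ D₀ D q' ≤-refl ≤-refl refl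
        Q-large : 2 * (D * D) * m ≤ suc q' * suc q'
        Q-large = begin
          2 * (D * D) * m                  ≤⟨ *-monoʳ-≤ (2 * (D * D)) (≤-trans m≤q² (m≤m+n (q * q) _)) ⟩
          2 * (D * D) * (2 * (q * q))      ≡⟨ r₂ D q ⟩
          2 * D * q * (2 * D * q)          ≡⟨ cong (λ x → x * x) Q≡ ⟨
          suc q' * suc q'                  ∎

    -- A negation is to be proved, so the finitely many questions whether some route from `p` to `q`
    -- reads `v` may be taken as decided: excluded middle for each of them holds up to double
    -- negation.
    not-small : ¬ (size Z ≤ 2 ^ y)
    not-small N≤ = ¬¬-∀Fin (λ p → ¬¬-∀Fin (λ q → ¬¬-∀Fin (λ v → ¬¬-excluded-middle)))
      (λ occ? → not-small-decided occ? N≤)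

    -- If the bound failed at `u / v`, the size would be below `2 ^ s₀` with `s₀` one more than the
    -- integer part of `u / v`. This integer part is at most the `b`-th root of `n`, hence below
    -- `y`; so `s₀ ≤ y`, against `not-small`.
    power-bound : PowBound 2 1 1 b n (size Z)
    power-bound u v@(suc _) v>0 u^b≤ with 2 ^ u ≤? size Z ^ v * 1 ^ u
    ... | yes le = le
    ... | no ¬le = ⊥-elim (not-small (≤-trans (<⇒≤ N<) (^-monoʳ-≤ 2 s₀≤y)))
      where
      s₀ : ℕ
      s₀ = suc (u / v)
      u< : u < s₀ * v
      u< = begin-strict
        u                     ≡⟨ m≡m%n+[m/n]*n u v ⟩
        u % v + u / v * v     <⟨ +-monoˡ-< (u / v * v) (m%n<n u v) ⟩
        s₀ * v                ∎
      N< : size Z < 2 ^ s₀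
      N< = ^-cancel-< v (begin-strict
        size Z ^ v            ≡⟨ *-identityʳ (size Z ^ v) ⟨
        size Z ^ v * 1        ≡⟨ cong (size Z ^ v *_) (^-zeroˡ u) ⟨
        size Z ^ v * 1 ^ u    <⟨ ≰⇒> ¬le ⟩
        2 ^ u                 ≤⟨ ^-monoʳ-≤ 2 (<⇒≤ u<) ⟩
        2 ^ (s₀ * v)          ≡⟨ ^-*-assoc 2 s₀ v ⟨
        (2 ^ s₀) ^ v          ∎)
      s₀≤y : s₀ ≤ y
      s₀≤y = ^-cancel-< b (≤-<-trans (*-cancelʳ-≤ ((u / v) ^ b) n (v ^ b) {{m^n≢0 v b}} (begin
        (u / v) ^ b * v ^ b   ≡⟨ ^-distribʳ-* b (u / v) v ⟨
        (u / v * v) ^ b       ≤⟨ ^-monoˡ-≤ b (≤-trans (m≤n+m _ (u % v)) (≤-reflexive (sym (m≡m%n+[m/n]*n u v)))) ⟩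
        u ^ b                 ≤⟨ u^b≤ ⟩
        n ^ 1 * v ^ b         ≡⟨ cong (_* v ^ b) (*-identityʳ n) ⟩
        n * v ^ b             ∎)) n<y^b)

theorem4 : ∃[ p ] ∃[ q ] ∃[ a ] ∃[ b ] (0 < q × q < p × 0 < a × a < b ×
    ∃[ n₀ ] (∀ n → n₀ ≤ n → (H : BTBG n) → Pseudoexpander H →
    ∀ d → 2 ^ (100000 * d) ≤ n →
    (Z : NBP n) → IsDNBP Z d → Computes Z (Phi H) →
    PowBound p q a b n (size Z)))
-- `α = 2` and `β = 1 / 400`: the argument excludes sizes up to `2 ^ y`, where `n < y ^ 400`.
theorem4 = 2 , 1 , 1 , 400 , s≤s z≤n , s≤s (s≤s z≤n) , s≤s z≤n , s≤s (s≤s z≤n) , Z₀ ^ 400 ,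
  λ n n-large H (height , expansion) d d-small Z dnbp computes →
    power-bound n-large H height expansion d d-small Z dnbp computes
  where
  -- The root taken of `m` is the 100th, `400 = 4 * 100`, and 999 and 1000 come from the expansion
  -- condition. The others are `404 = 400 + 4`, `14545 = 404 * 36 + 1`,
  -- `301605120 = 64 * 324 * 14545` and `100000 = 250 * 400`.
  open Main 99 400 999 1000 404 14545 301605120 100000 (m≤m+n 33 67) refl refl refl ≤-refl ≤-refl ≤-refl refl
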